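{- Let $G$ be a $4$-cactus with $n$ vertices. Then $|E(G)|\le 2n-2$ if $n\equiv 1 \pmod 3$, and $|E(G)|\le 2n-3$ otherwise. Moreover, these bounds are tight: for every $n\ge 1$ there is a $4$-cactus with $n$ vertices attaining the corresponding bound.
   Context: All graphs are finite and simple. For an integer $k\ge 1$, a $k$-cactus is a connected graph in which every edge is contained in at most $k$ cycles. -}

module Defs where

open import Data.Nat using (ℕ; zero; suc; _+_; _*_; _≤_; _%_) renaming (_<?_ to _<ℕ?_)
open import Data.Fin using (Fin; zero; suc; toℕ; inject₁; fromℕ)
open import Data.Bool using (Bool; true; false; if_then_else_; _∧_)
open import Data.List using (List; length; allFin; concatMap; map)
open import Data.Nat.ListAction using (sum)
open import Data.Product using (Σ; _×_; _,_; ∃)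
open import Data.Sum using (_⊎_)
open import Data.Vec.Functional using (Vector)
open import Function.Definitions using (Injective)
open import Relation.Binary.PropositionalEquality using (_≡_; _≢_)
open import Relation.Nullary using (¬_)
open import Relation.Nullary.Decidable using (⌊_⌋)

record Graph (n : ℕ) : Set where
  field
    adj     : Fin n → Fin n → Bool
    symm    : ∀ u v → adj u v ≡ adj v u
    irrefl  : ∀ u → adj u u ≡ false
open Graph public

Adj : ∀ {n} → Graph n → Fin n → Fin n → Set
Adj G u v = adj G u v ≡ true

edgeCount : ∀ {n} → Graph n → ℕ
edgeCount {n} G =
  sum (concatMap (λ i → map (λ j → if ⌊ toℕ i <ℕ? toℕ j ⌋ ∧ adj G i j then 1 else 0)
                             (allFin n))
                 (allFin n))

data Walk {n} (G : Graph n) : Fin n → Fin n → Set where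
  [] : ∀ {u} → Walk G u u
  _∷_ : ∀ {u v w} → Adj G u v → Walk G v w → Walk G u w

Connected : ∀ {n} → Graph n → Set
Connected G = ∀ u v → Walk G u v

record Cycle {n} (G : Graph n) : Set where
  field
    m     : ℕ
    vtx   : Fin (suc (suc (suc m))) → Fin n
    inj   : Injective _≡_ _≡_ vtx
    step  : ∀ (i : Fin (suc (suc m))) → Adj G (vtx (inject₁ i)) (vtx (suc i))
    close : Adj G (vtx (fromℕ (suc (suc m)))) (vtx zero)
open Cycle public

SameEdge : ∀ {n} → Fin n → Fin n → Fin n → Fin n → Set
SameEdge a b u v = (u ≡ a × v ≡ b) ⊎ (u ≡ b × v ≡ a)

OnCycle : ∀ {n} {G : Graph n} → Cycle G → Fin n → Fin n → Set
OnCycle c u v =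
  (Σ (Fin (suc (suc (m c)))) λ i → SameEdge (vtx c (inject₁ i)) (vtx c (suc i)) u v)
  ⊎ SameEdge (vtx c (fromℕ (suc (suc (m c))))) (vtx c zero) u v

SameCycle : ∀ {n} {G : Graph n} → Cycle G → Cycle G → Set
SameCycle c c' = ∀ u v → (OnCycle c u v → OnCycle c' u v) × (OnCycle c' u v → OnCycle c u v)

-- every edge lies in at most k (distinct) cycles: among any k+1 cycles
-- through a given edge, two coincide.
EdgesInAtMostCycles : ∀ {n} → ℕ → Graph n → Set
EdgesInAtMostCycles {n} k G =
  ∀ (u v : Fin n) → Adj G u v →
  (cs : Vector (Cycle G) (suc k)) → (∀ i → OnCycle (cs i) u v) →
  Σ (Fin (suc k)) λ i → Σ (Fin (suc k)) λ j → i ≢ j × SameCycle (cs i) (cs j)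

IsCactus : ∀ {n} → ℕ → Graph n → Set
IsCactus k G = Connected G × EdgesInAtMostCycles k G

-- the bound of Theorem 4, stated additively:  |E| + 2 = 2n resp. |E| + 3 = 2n
Slack : ℕ → ℕ
Slack n with n % 3
... | suc zero = 2
... | _ = 3

{-# OPTIONS --safe #-}
module Submission where

-- Upper bound.  Cutting a connected graph at a cut vertex splits its edges, and the bound adds up over the two sides,
-- so it suffices to treat a graph B without cut vertices.  Up to four vertices the bound is |B| choose 2, and on five
-- vertices eight edges force an edge in five cycles.  In general B has at most |B| + 3 edges: fix an edge
-- pq and build B from it by adding ears, keeping the vertices in an order from p to q in which every vertex has an
-- earlier neighbour (except p) and a later one (except q).  An ear from a to a later b can then be extended down
-- to p and up to q, so every ear yields a new cycle through pq; hence there are at most four ears.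
--
-- Tightness.  Let copies of K₄ (and, depending on n mod 3, one K₂ or K₃) share a hub.  A cycle meets the hub at most
-- once, so it stays in one copy, and an edge of K₄ lies in exactly four cycles.

open import Defs
open import Data.Bool using (Bool; true; false; if_then_else_; not; _∧_; _∨_)
open import Data.Bool.Properties using (∨-zeroʳ; T-≡; T-∧) renaming (_≟_ to _≟ᵇ_)
open import Data.Empty using (⊥)
open import Data.Fin using (Fin; zero; suc; toℕ; inject₁; fromℕ) renaming (_<_ to _<ᶠ_)
open import Data.Fin.Patterns
open import Data.Fin.Properties using (all?; toℕ-injective; injective⇒≤; pigeonhole) renaming (_≟_ to _≟ᶠ_; any? to anyFin?; <⇒≢ to <ᶠ⇒≢; suc-injective to sucᶠ-injective)
open import Data.List using (List; []; _∷_; _++_; _ʳ++_; [_]; length; map; concatMap; filter; reverse; lookup; tabulate; allFin)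
open import Data.List.Properties using (length-++; length-tabulate; ++-assoc; ++-identityʳ; ++-ʳ++; ʳ++-defn)
open import Data.List.Membership.Propositional using (_∈_; _∉_; find; lose)
open import Data.List.Membership.Propositional.Properties using (∈-∃++; ∈-++⁺ˡ; ∈-++⁺ʳ; ∈-++⁻; ∈-lookup; ∈-allFin)
import Data.List.Membership.DecPropositional as DecMembership
open import Data.List.Relation.Binary.Permutation.Propositional using (_↭_; refl; prep; swap; ↭-refl; ↭-reflexive; ↭-sym; ↭-trans; ↭⇒↭ₛ) renaming (trans to _⟫_)
open import Data.List.Relation.Binary.Permutation.Propositional.Properties using (shift; shifts; drop-∷; ∈-resp-↭; ↭-length; ↭-reverse; ++⁺ˡ; ++-comm)
import Data.List.Relation.Binary.Permutation.Setoid.Properties as PermutationSetoid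
open import Data.List.Relation.Unary.All as All using (All; []; _∷_)
open import Data.List.Relation.Unary.All.Properties using (¬Any⇒All¬) renaming (++⁻ˡ to All-++⁻ˡ)
open import Data.List.Relation.Unary.AllPairs using (AllPairs; []; _∷_)
import Data.List.Relation.Unary.AllPairs.Properties as AllPairs
open import Data.List.Relation.Unary.Any as Any using (Any; here; there; any?)
open import Data.List.Relation.Unary.Any.Properties using () renaming (++⁺ˡ to Any-++⁺ˡ; ++⁺ʳ to Any-++⁺ʳ; ++⁻ to Any-++⁻)
open import Data.List.Relation.Unary.Unique.Propositional using (Unique)
open import Data.List.Relation.Unary.Unique.Propositional.Properties using (Unique[x∷xs]⇒x∉xs; allFin⁺)
import Data.List.Relation.Unary.Unique.Propositional.Properties as Unique
open import Data.Nat using (ℕ; zero; suc; pred; _+_; _*_; _≤_; _<_; z≤n; s≤s; s≤s⁻¹; _≤?_; _≡ᵇ_) renaming (_<?_ to _<ℕ?_)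
open import Data.Nat.ListAction using (sum)
open import Data.Nat.ListAction.Properties using (sum-++)
open import Data.Nat.Properties
open import Algebra.Properties.CommutativeSemigroup +-commutativeSemigroup using (interchange; x∙yz≈y∙xz)
open import Data.Nat.Tactic.RingSolver using (solve-∀)
open import Data.Product using (Σ; ∃; ∃₂; _×_; _,_; proj₁; proj₂)
open import Data.Product.Properties using (≡-dec)
open import Data.Sum using (_⊎_; inj₁; inj₂; [_,_]′) renaming (swap to ⊎-swap; map to ⊎-map)
open import Data.Unit using (⊤; tt)
open import Data.Vec as Vec using (Vec; []; _∷_)
import Data.Vec.Functional as Vector
open import Data.Vec.Properties using (lookup∘tabulate)
open import Function using (_∘_; id; Equivalence)
open import Function.Definitions using (Injective)
open import Relation.Binary.Construct.Closure.ReflexiveTransitive as Star using (Star; ε; _◅_; _◅◅_)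
open import Relation.Binary.PropositionalEquality using (_≡_; _≢_; refl; sym; trans; cong; cong₂; subst; setoid; ≡-≟-identity)
open import Relation.Nullary using (¬_; yes; no; Dec; contradiction)
open import Relation.Nullary.Decidable using (_×-dec_; _⊎-dec_; _→-dec_; ¬?; ⌊_⌋; True; toWitness; map′)

-- Counting adjacent pairs in a list

-- Writing both cases as an additive `Slack` of 2 or 3 turns gluing at a cut vertex into an
-- inequality between slacks: the shared vertex is counted twice, which costs 2 on the side of
-- `2 * n`. An ear with k interior vertices adds k + 1 edges, so a single edge on two vertices
-- followed by at most four ears gives at most |B| + 3 edges. This is at most 2|B| - 3 exactly from
-- six vertices on. On five vertices it gives 8 where 7 is wanted, and this gap of one is why that
-- size needs a search of its own. The order from p to q is an st-numbering. It keeps all the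
-- counted cycles on the one edge pq. They are pairwise distinct because each uses the first edge of
-- its own ear, which no earlier subgraph contains. A chord is treated as an ear without interior
-- vertices.

module _ {A : Set} where

  Unique-resp-↭ : ∀ {xs ys : List A} → xs ↭ ys → Unique xs → Unique ys
  Unique-resp-↭ p = PermutationSetoid.Unique-resp-↭ (setoid A) (↭⇒↭ₛ p)

  unique-length-≤ : ∀ {xs ys : List A} → Unique xs → (∀ {x} → x ∈ xs → x ∈ ys) → length xs ≤ length ys
  unique-length-≤ {[]} u sub = z≤n
  unique-length-≤ {x ∷ xs} {ys} (x∉ ∷ u) sub with ∈-∃++ (sub (here refl))
  ... | as , bs , refl = ≤-trans (s≤s (unique-length-≤ u sub′)) (≤-reflexive (sym (↭-length (shift x as bs))))
    where
    sub′ : ∀ {y} → y ∈ xs → y ∈ as ++ bs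
    sub′ y∈ with ∈-resp-↭ (shift x as bs) (sub (there y∈))
    ... | here refl = contradiction y∈ (Unique[x∷xs]⇒x∉xs (x∉ ∷ u))
    ... | there q = q

  Unique-++⁻ʳ : ∀ (xs : List A) {ys} → Unique (xs ++ ys) → Unique ys
  Unique-++⁻ʳ []       u       = u
  Unique-++⁻ʳ (x ∷ xs) (_ ∷ u) = Unique-++⁻ʳ xs u

  Unique-++⁻ˡ : ∀ (xs : List A) {ys} → Unique (xs ++ ys) → Unique xs
  Unique-++⁻ˡ []       u       = []
  Unique-++⁻ˡ (x ∷ xs) (h ∷ u) = All-++⁻ˡ xs h ∷ Unique-++⁻ˡ xs u

  Unique-++⇒disjoint : ∀ (xs : List A) {ys} → Unique (xs ++ ys) → ∀ {x} → x ∈ xs → x ∉ ys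
  Unique-++⇒disjoint (x ∷ xs) u       (here refl) j = Unique[x∷xs]⇒x∉xs u (∈-++⁺ʳ xs j)
  Unique-++⇒disjoint (x ∷ xs) (_ ∷ u) (there i)   j = Unique-++⇒disjoint xs u i j

indicator : Bool → ℕ
indicator b = if b then 1 else 0

indicator≤1 : ∀ b → indicator b ≤ 1
indicator≤1 true  = ≤-refl
indicator≤1 false = z≤n

module _ {A : Set} where

  count : (A → Bool) → List A → ℕ
  count p []       = 0
  count p (x ∷ xs) = indicator (p x) + count p xs

  pairs : (A → A → Bool) → List A → ℕ
  pairs a []       = 0
  pairs a (x ∷ xs) = count (a x) xs + pairs a xs

  count-++ : ∀ p xs ys → count p (xs ++ ys) ≡ count p xs + count p ys
  count-++ p []       ys = refl
  count-++ p (x ∷ xs) ys = trans (cong (indicator (p x) +_) (count-++ p xs ys)) (sym (+-assoc (indicator (p x)) _ _))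

  count≤length : ∀ p xs → count p xs ≤ length xs
  count≤length p []       = z≤n
  count≤length p (x ∷ xs) = +-mono-≤ (indicator≤1 (p x)) (count≤length p xs)

  count-↭ : ∀ p {xs ys} → xs ↭ ys → count p xs ≡ count p ys
  count-↭ p refl         = refl
  count-↭ p (prep x σ)   = cong (indicator (p x) +_) (count-↭ p σ)
  count-↭ p {_} {_ ∷ _ ∷ ys} (swap x y σ) =
    trans (cong (λ k → indicator (p x) + (indicator (p y) + k)) (count-↭ p σ))
          (x∙yz≈y∙xz (indicator (p x)) (indicator (p y)) (count p ys))
  count-↭ p (σ ⟫ τ)  = trans (count-↭ p σ) (count-↭ p τ)

  count-none : ∀ p xs → (∀ {x} → x ∈ xs → p x ≡ false) → count p xs ≡ 0
  count-none p []       none = refl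
  count-none p (x ∷ xs) none rewrite none (here refl) = count-none p xs (none ∘ there)

  count-mono : ∀ {p q} xs → (∀ {x} → x ∈ xs → p x ≡ true → q x ≡ true) → count p xs ≤ count q xs
  count-mono [] imp = z≤n
  count-mono {p} {q} (x ∷ xs) imp with p x in px
  ... | false = ≤-trans (count-mono xs (imp ∘ there)) (m≤n+m _ _)
  ... | true rewrite imp (here refl) px = s≤s (count-mono xs (imp ∘ there))

  pairs-↭ : ∀ a → (∀ x y → a x y ≡ a y x) → ∀ {xs ys} → xs ↭ ys → pairs a xs ≡ pairs a ys
  pairs-↭ a s refl       = refl
  pairs-↭ a s (prep x σ) = cong₂ _+_ (count-↭ (a x) σ) (pairs-↭ a s σ)
  pairs-↭ a s {_} {_ ∷ _ ∷ ys} (swap x y σ)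
    rewrite s x y | count-↭ (a x) σ | count-↭ (a y) σ | pairs-↭ a s σ =
    interchange (indicator (a y x)) (count (a x) ys) (count (a y) ys) (pairs a ys)
  pairs-↭ a s (σ ⟫ τ) = trans (pairs-↭ a s σ) (pairs-↭ a s τ)

  pairs-mono : ∀ {a b} xs → (∀ {x y} → x ∈ xs → y ∈ xs → a x y ≡ true → b x y ≡ true) → pairs a xs ≤ pairs b xs
  pairs-mono []       imp = z≤n
  pairs-mono (x ∷ xs) imp =
    +-mono-≤ (count-mono xs λ y∈ → imp (here refl) (there y∈)) (pairs-mono xs λ x∈ y∈ → imp (there x∈) (there y∈))

  pairs-separated : ∀ a xs ys → (∀ {x y} → x ∈ xs → y ∈ ys → a x y ≡ false) → pairs a (xs ++ ys) ≡ pairs a xs + pairs a ys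
  pairs-separated a []       ys sep = refl
  pairs-separated a (x ∷ xs) ys sep
    rewrite count-++ (a x) xs ys | count-none (a x) ys (sep (here refl)) | +-identityʳ (count (a x) xs)
          | pairs-separated a xs ys (sep ∘ there) = sym (+-assoc (count (a x) xs) _ _)

  -- Here `x` plays the cut vertex: it belongs to both sides, yet each pair containing it is counted
  -- on one side only.
  pairs-glue : ∀ a x ys zs → (∀ {y z} → y ∈ ys → z ∈ zs → a y z ≡ false) →
    pairs a (x ∷ ys ++ zs) ≡ pairs a (x ∷ ys) + pairs a (x ∷ zs)
  pairs-glue a x ys zs sep rewrite count-++ (a x) ys zs | pairs-separated a ys zs sep =
    interchange (count (a x) ys) (count (a x) zs) (pairs a ys) (pairs a zs)

  count-∨ : ∀ p q xs → count (λ x → p x ∨ q x) xs ≤ count p xs + count q xs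
  count-∨ p q [] = z≤n
  count-∨ p q (x ∷ xs) = ≤-trans (+-mono-≤ (ind (p x) (q x)) (count-∨ p q xs))
    (≤-reflexive (interchange (indicator (p x)) (indicator (q x)) (count p xs) (count q xs)))
    where
    ind : ∀ b c → indicator (b ∨ c) ≤ indicator b + indicator c
    ind true  c = s≤s z≤n
    ind false c = ≤-refl

  pairs-∨ : ∀ a b xs → pairs (λ x y → a x y ∨ b x y) xs ≤ pairs a xs + pairs b xs
  pairs-∨ a b [] = z≤n
  pairs-∨ a b (x ∷ xs) = ≤-trans (+-mono-≤ (count-∨ (a x) (b x) xs) (pairs-∨ a b xs))
    (≤-reflexive (interchange (count (a x) xs) (count (b x) xs) (pairs a xs) (pairs b xs)))

module _ {n : ℕ} where

  private V = Fin n

  edgeCount≡pairs : (G : Graph n) → edgeCount G ≡ pairs (adj G) (allFin n)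
  edgeCount≡pairs G = rows (allFin n) (AllPairs.tabulate⁺-< (λ i<j → i<j))
    where
    entry : V → V → ℕ
    entry i j = if ⌊ toℕ i <ℕ? toℕ j ⌋ ∧ adj G i j then 1 else 0

    entry-< : ∀ {i j} → i <ᶠ j → entry i j ≡ indicator (adj G i j)
    entry-< {i} {j} i<j with toℕ i <ℕ? toℕ j
    ... | yes _   = refl
    ... | no  i≮j = contradiction i<j i≮j

    entry-≮ : ∀ {i j} → ¬ (i <ᶠ j) → entry i j ≡ 0
    entry-≮ {i} {j} i≮j with toℕ i <ℕ? toℕ j
    ... | yes i<j = contradiction i<j i≮j
    ... | no  _   = refl

    row : ∀ i js → All (i <ᶠ_) js → sum (map (entry i) js) ≡ count (adj G i) js
    row i []       []        = refl
    row i (j ∷ js) (i<j ∷ h) = cong₂ _+_ (entry-< i<j) (row i js h)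

    -- An edge is counted only from its smaller end, so the column of `v` vanishes in all rows below
    -- that of `v`. Removing the least vertex therefore costs just its row.
    drop-column : ∀ (v : V) (is js : List V) → All (v <ᶠ_) is →
      sum (concatMap (λ i → map (entry i) (v ∷ js)) is) ≡ sum (concatMap (λ i → map (entry i) js) is)
    drop-column v []       js []        = refl
    drop-column v (i ∷ is) js (v<i ∷ h)
      rewrite entry-≮ {i} {v} (<-asym v<i)
            | sum-++ (map (entry i) js) (concatMap (λ i → map (entry i) (v ∷ js)) is)
            | sum-++ (map (entry i) js) (concatMap (λ i → map (entry i) js) is)
            | drop-column v is js h = refl

    rows : ∀ (is : List V) → AllPairs _<ᶠ_ is → sum (concatMap (λ i → map (entry i) is) is) ≡ pairs (adj G) is
    rows []       []      = refl
    rows (v ∷ is) (h ∷ s)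
      rewrite entry-≮ {v} {v} (<-irrefl refl)
            | sum-++ (map (entry v) is) (concatMap (λ i → map (entry i) (v ∷ is)) is)
            | drop-column v is is h = cong₂ _+_ (row v is h) (rows is s)

  sameEdge : V × V → V → V → Bool
  sameEdge (a , b) x y = (⌊ x ≟ᶠ a ⌋ ∧ ⌊ y ≟ᶠ b ⌋) ∨ (⌊ x ≟ᶠ b ⌋ ∧ ⌊ y ≟ᶠ a ⌋)

  count-≡ : ∀ (b : V) {xs} → Unique xs → count (λ x → ⌊ x ≟ᶠ b ⌋) xs ≤ 1
  count-≡ b []       = z≤n
  count-≡ b {x ∷ xs} (h ∷ u) with x ≟ᶠ b
  ... | no  _    = count-≡ b u
  ... | yes refl = ≤-reflexive (cong suc (count-none _ xs λ {y} y∈ → other y (All.lookup h y∈)))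
    where
    other : ∀ y → b ≢ y → ⌊ y ≟ᶠ b ⌋ ≡ false
    other y b≢y with y ≟ᶠ b
    ... | yes refl = contradiction refl b≢y
    ... | no  _    = refl

  pairs-none : ∀ (a : V → V → Bool) xs → (∀ {x y} → x ∈ xs → y ∈ xs → a x y ≡ false) → pairs a xs ≡ 0
  pairs-none a []       none = refl
  pairs-none a (x ∷ xs) none
    rewrite count-none (a x) xs (λ y∈ → none (here refl) (there y∈)) = pairs-none a xs λ x∈ y∈ → none (there x∈) (there y∈)

  pairs-sameEdge : ∀ a b → a ≢ b → ∀ {xs} → Unique xs → pairs (sameEdge (a , b)) xs ≤ 1
  pairs-sameEdge a b a≢b [] = z≤n
  pairs-sameEdge a b a≢b {x ∷ xs} (h ∷ u) with x ≟ᶠ a | x ≟ᶠ b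
  ... | yes refl | yes refl = contradiction refl a≢b
  ... | no _     | no _     = subst (_≤ 1)
      (sym (cong (_+ pairs (sameEdge (a , b)) xs) (count-none _ xs λ _ → refl)))
      (pairs-sameEdge a b a≢b u)
  ... | yes refl | no _     = subst (_≤ 1)
      (sym (trans (cong (count _ xs +_) (pairs-none _ xs λ p q → off (All.lookup h p) (All.lookup h q))) (+-identityʳ _)))
      (≤-trans (count-mono xs λ _ → drop _) (count-≡ b u))
    where
    drop : ∀ c → c ∨ false ≡ true → c ≡ true
    drop true _ = refl
    off : ∀ {y z} → x ≢ y → x ≢ z → sameEdge (x , b) y z ≡ false
    off {y} {z} p q with y ≟ᶠ x | z ≟ᶠ x | y ≟ᶠ b
    ... | yes refl | _ | _ = contradiction refl p
    ... | no _ | yes refl | _ = contradiction refl q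
    ... | no _ | no _ | yes _ = refl
    ... | no _ | no _ | no _ = refl
  ... | no _ | yes refl = subst (_≤ 1)
      (sym (trans (cong (count _ xs +_) (pairs-none _ xs λ p q → off (All.lookup h p) (All.lookup h q))) (+-identityʳ _)))
      (count-≡ a u)
    where
    off : ∀ {y z} → x ≢ y → x ≢ z → sameEdge (a , x) y z ≡ false
    off {y} {z} p q with y ≟ᶠ x | z ≟ᶠ x | y ≟ᶠ a
    ... | yes refl | _ | _ = contradiction refl p
    ... | no _ | yes refl | _ = contradiction refl q
    ... | no _ | no _ | yes _ = refl
    ... | no _ | no _ | no _ = refl

  Joins : List (V × V) → V → V → Set
  Joins L x y = (x , y) ∈ L ⊎ (y , x) ∈ L

  joinsᵇ : List (V × V) → V → V → Bool
  joinsᵇ []      x y = false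
  joinsᵇ (e ∷ L) x y = sameEdge e x y ∨ joinsᵇ L x y

  sameEdge-refl : ∀ x y → sameEdge (x , y) x y ≡ true
  sameEdge-refl x y rewrite ≡-≟-identity _≟ᶠ_ {x} refl | ≡-≟-identity _≟ᶠ_ {y} refl = refl

  sameEdge-swap : ∀ x y → sameEdge (y , x) x y ≡ true
  sameEdge-swap x y rewrite ≡-≟-identity _≟ᶠ_ {x} refl | ≡-≟-identity _≟ᶠ_ {y} refl = ∨-zeroʳ _

  Joins⇒joinsᵇ : ∀ L {x y} → Joins L x y → joinsᵇ L x y ≡ true
  Joins⇒joinsᵇ (_ ∷ L) {x} {y} (inj₁ (here refl)) = cong (_∨ joinsᵇ L x y) (sameEdge-refl x y)
  Joins⇒joinsᵇ (_ ∷ L) {x} {y} (inj₂ (here refl)) = cong (_∨ joinsᵇ L x y) (sameEdge-swap x y)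
  Joins⇒joinsᵇ (e ∷ L) {x} {y} (inj₁ (there j)) = trans (cong (sameEdge e x y ∨_) (Joins⇒joinsᵇ L (inj₁ j))) (∨-zeroʳ _)
  Joins⇒joinsᵇ (e ∷ L) {x} {y} (inj₂ (there j)) = trans (cong (sameEdge e x y ∨_) (Joins⇒joinsᵇ L (inj₂ j))) (∨-zeroʳ _)

  -- Each listed edge accounts for at most one pair of a duplicate-free list. The ear construction
  -- can thus track the length of an edge list in place of an edge count.
  pairs-joinsᵇ : ∀ L → All (λ (a , b) → a ≢ b) L → ∀ {xs} → Unique xs → pairs (joinsᵇ L) xs ≤ length L
  pairs-joinsᵇ []            []      {xs} u = ≤-reflexive (pairs-none _ xs λ _ _ → refl)
  pairs-joinsᵇ ((a , b) ∷ L) (p ∷ ps) {xs} u =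
    ≤-trans (pairs-∨ (sameEdge (a , b)) (joinsᵇ L) xs) (+-mono-≤ (pairs-sameEdge a b p u) (pairs-joinsᵇ L ps u))

-- Paths, closed paths and vertex orders

module _ {A : Set} where

  lookup-injective : ∀ {xs : List A} → Unique xs → ∀ {i j} → lookup xs i ≡ lookup xs j → i ≡ j
  lookup-injective (h ∷ u) {zero}  {zero}  eq = refl
  lookup-injective (h ∷ u) {zero}  {suc j} eq = contradiction eq (All.lookup h (∈-lookup j))
  lookup-injective (h ∷ u) {suc i} {zero}  eq = contradiction (sym eq) (All.lookup h (∈-lookup i))
  lookup-injective (h ∷ u) {suc i} {suc j} eq = cong suc (lookup-injective u eq)

  data Consecutive : List A → A → A → Set where
    here  : ∀ {x y xs} → Consecutive (x ∷ y ∷ xs) x y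
    there : ∀ {x y z xs} → Consecutive xs x y → Consecutive (z ∷ xs) x y

  Consecutive-lookup : ∀ {x y z xs} → Consecutive (z ∷ xs) x y →
    Σ (Fin (length xs)) λ i → lookup (z ∷ xs) (inject₁ i) ≡ x × lookup xs i ≡ y
  Consecutive-lookup {xs = _ ∷ _} here = zero , refl , refl
  Consecutive-lookup {xs = _ ∷ _} (there c) with Consecutive-lookup c
  ... | i , p , q = suc i , p , q

  lastOr : A → List A → A
  lastOr d []       = d
  lastOr d (x ∷ xs) = lastOr x xs

  lastOr-++-∷ : ∀ d xs y ys → lastOr d (xs ++ y ∷ ys) ≡ lastOr y ys
  lastOr-++-∷ d []       y ys = refl
  lastOr-++-∷ d (x ∷ xs) y ys = lastOr-++-∷ x xs y ys

  splitFirst : ∀ {P : A → Set} → (∀ x → Dec (P x)) → ∀ xs →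
    (∃ λ ys → ∃₂ λ x zs → xs ≡ (ys ++ [ x ]) ++ zs × P x × All (¬_ ∘ P) ys) ⊎ All (¬_ ∘ P) xs
  splitFirst P? []       = inj₂ []
  splitFirst P? (x ∷ xs) with P? x
  ... | yes p = inj₁ ([] , x , xs , refl , p , [])
  ... | no ¬p with splitFirst P? xs
  ...   | inj₁ (ys , z , zs , refl , p , h) = inj₁ (x ∷ ys , z , zs , refl , p , ¬p ∷ h)
  ...   | inj₂ h = inj₂ (¬p ∷ h)

  module _ (R : A → A → Set) where

    data Path : A → A → List A → Set where
      stop : ∀ {x} → Path x x [ x ]
      go   : ∀ {x y z l} → R x y → x ∉ l → Path y z l → Path x z (x ∷ l)

    -- One half of an st-numbering: every entry but the last has a neighbour further on. The other
    -- half is the same condition on the reversed list.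
    Up : List A → Set
    Up []       = ⊤
    Up (x ∷ xs) = (xs ≡ [] ⊎ Any (R x) xs) × Up xs

    record ClimbsTo (z : A) (xs : List A) : Set where
      constructor climbs
      field
        up   : Up xs
        ends : lastOr z xs ≡ z

  module _ {R : A → A → Set} where

    Path-unique : ∀ {x y l} → Path R x y l → Unique l
    Path-unique stop       = [] ∷ []
    Path-unique (go r h p) = ¬Any⇒All¬ _ h ∷ Path-unique p

    Path-step : ∀ {x y z l} → Path R x y (z ∷ l) → ∀ i → R (lookup (z ∷ l) (inject₁ i)) (lookup l i)
    Path-step (go r h stop)         zero    = r
    Path-step (go r h (go _ _ _))   zero    = r
    Path-step (go r h p@(go _ _ _)) (suc i) = Path-step p i

    Path-last : ∀ {x y z l} → Path R x y (z ∷ l) → lookup (z ∷ l) (fromℕ (length l)) ≡ y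
    Path-last stop                  = refl
    Path-last (go r h stop)         = refl
    Path-last (go r h p@(go _ _ _)) = Path-last p

    Path-first : ∀ {x y z l} → Path R x y (z ∷ l) → z ≡ x
    Path-first stop       = refl
    Path-first (go r h p) = refl

    -- A path on two vertices has only the pair `x`, `y` to offer; any other consecutive pair forces
    -- a third vertex, as a cycle requires.
    Path-long : ∀ {x y a b l} → Path R x y l → Consecutive l a b → ¬ (a ≡ x × b ≡ y) → 3 ≤ length l
    Path-long (go r h stop) here         ne = contradiction (refl , refl) ne
    Path-long (go r h stop) (there (there ())) ne
    Path-long (go r h (go _ _ stop)) c   ne = s≤s (s≤s (s≤s z≤n))
    Path-long (go r h (go _ _ (go _ _ _))) c ne = s≤s (s≤s (s≤s z≤n))

    Up-++⁻ʳ : ∀ xs {ys} → Up R (xs ++ ys) → Up R ys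
    Up-++⁻ʳ []       u       = u
    Up-++⁻ʳ (x ∷ xs) (_ , u) = Up-++⁻ʳ xs u

    -- Neighbours that lay ahead still lie ahead after the insertion. The common tail is nonempty,
    -- so no entry of `xs` or `ys` relies on the exemption of a last entry.
    Up-insert : ∀ xs ys z zs → Up R (xs ++ z ∷ zs) → Up R (ys ++ z ∷ zs) → Up R (xs ++ ys ++ z ∷ zs)
    Up-insert []             ys z zs u            v = v
    Up-insert (x ∷ [])       ys z zs (inj₂ r , u) v = inj₂ (Any-++⁺ʳ ys r) , v
    Up-insert (x ∷ xs@(_ ∷ _)) ys z zs (inj₂ r , u) v = inj₂ (grow (Any-++⁻ xs r)) , Up-insert xs ys z zs u v
      where
      grow : Any (R x) xs ⊎ Any (R x) (z ∷ zs) → Any (R x) (xs ++ ys ++ z ∷ zs)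
      grow (inj₁ i) = Any-++⁺ˡ i
      grow (inj₂ i) = Any-++⁺ʳ xs (Any-++⁺ʳ ys i)

    ClimbsTo-insert : ∀ {t} xs ys z zs → ClimbsTo R t (xs ++ z ∷ zs) → Up R (ys ++ z ∷ zs) →
      ClimbsTo R t (xs ++ ys ++ z ∷ zs)
    ClimbsTo-insert {t} xs ys z zs (climbs u e) v = climbs (Up-insert xs ys z zs u v)
      (trans (trans (cong (lastOr t) (sym (++-assoc xs ys (z ∷ zs)))) (lastOr-++-∷ t (xs ++ ys) z zs))
             (trans (sym (lastOr-++-∷ t xs z zs)) e))

    -- Moving to a later neighbour advances in the list, so no vertex repeats. The recursion takes
    -- `R x` for `P` in order to find the successor of `x`.
    climb : ∀ {P : A → Set} d xs → Any P xs → Up R xs → Unique xs →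
      ∃₂ λ y l → P y × Path R y (lastOr d xs) l × (∀ {z} → z ∈ l → z ∈ xs)
    climb d (x ∷ xs) (here p) (inj₁ refl , u) _ = x , [ x ] , p , stop , id
    climb d (x ∷ xs) (here p) (inj₂ r , u) (h ∷ un) with climb x xs r u un
    ... | y , l , s , path , l⊆ =
      x , x ∷ l , p , go s (Unique[x∷xs]⇒x∉xs (h ∷ un) ∘ l⊆) path , λ { (here e) → here e ; (there i) → there (l⊆ i) }
    climb d (x ∷ xs) (there a) (_ , u) (h ∷ un) with climb x xs a u un
    ... | y , l , p , path , l⊆ = y , l , p , path , there ∘ l⊆

    -- The counterpart of `climb` for a path that is already there and grows at its front.
    -- Consecutive pairs are tracked because one of them will tell the new cycle from the old ones.
    prepend : (∀ {x y} → R x y → R y x) → ∀ d xs {y z l} → Any (R y) xs → Up R xs → Unique xs →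
      Path R y z l → (∀ {w} → w ∈ l → w ∉ xs) →
      ∃ λ l′ → Path R (lastOr d xs) z l′ × (∀ {a b} → Consecutive l a b → Consecutive l′ a b)
    prepend s d (x ∷ xs) {l = l} (here r) (st , u) (h ∷ un) path fresh = continue st
      where
      path′ = go (s r) (λ i → fresh i (here refl)) path
      fresh′ : ∀ {w} → w ∈ x ∷ l → w ∉ xs
      fresh′ (here refl) i = Unique[x∷xs]⇒x∉xs (h ∷ un) i
      fresh′ (there j)   i = fresh j (there i)
      continue : xs ≡ [] ⊎ Any (R x) xs →
        ∃ λ l′ → Path R (lastOr x xs) _ l′ × (∀ {a b} → Consecutive l a b → Consecutive l′ a b)
      continue (inj₁ refl) = x ∷ l , path′ , there
      continue (inj₂ a) with prepend s x xs a u un path′ fresh′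
      ... | l′ , p , c = l′ , p , c ∘ there
    prepend s d (x ∷ xs) (there a) (_ , u) (h ∷ un) path fresh = prepend s x xs a u un path (λ i → fresh i ∘ there)

  Up-mono : ∀ {R S : A → A → Set} → (∀ {x y} → R x y → S x y) → ∀ xs → Up R xs → Up S xs
  Up-mono f []       u        = tt
  Up-mono f (x ∷ xs) (st , u) = ⊎-map id (Any.map f) st , Up-mono f xs u

  ClimbsTo-mono : ∀ {R S : A → A → Set} → (∀ {x y} → R x y → S x y) → ∀ {z xs} → ClimbsTo R z xs → ClimbsTo S z xs
  ClimbsTo-mono f {xs = xs} (climbs u e) = climbs (Up-mono f xs u) e

module _ {n : ℕ} (G : Graph n) where

  private
    V = Fin n

  Adj-sym : ∀ {x y} → Adj G x y → Adj G y x
  Adj-sym {x} {y} a = trans (symm G y x) a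

  Adj-irrefl : ∀ {x y} → Adj G x y → x ≢ y
  Adj-irrefl {x} a refl with () ← trans (sym a) (irrefl G x)

  closePath : ∀ {R : V → V → Set} → (∀ {x y} → R x y → R y x) → (∀ {x y} → R x y → Adj G x y) →
    ∀ {p q l} → Path R p q l → 3 ≤ length l → R p q →
    Σ (Cycle G) λ c → (∀ {x y} → OnCycle c x y → R x y) × (∀ {x y} → Consecutive l x y → OnCycle c x y) × OnCycle c p q
  closePath _ _ {l = _ ∷ []}     _ (s≤s ())
  closePath _ _ {l = _ ∷ _ ∷ []} _ (s≤s (s≤s ()))
  closePath {R} R-sym R⇒Adj {p} {q} {x ∷ y ∷ z ∷ r} path _ rpq = c , within , on , inj₂ (inj₂ (sym first , sym last))
    where
    first = Path-first path
    last  = Path-last path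
    closing : R (lookup (x ∷ y ∷ z ∷ r) (fromℕ (2 + length r))) x
    closing rewrite last | first = R-sym rpq
    c : Cycle G
    c = record
      { m     = length r
      ; vtx   = lookup (x ∷ y ∷ z ∷ r)
      ; inj   = lookup-injective (Path-unique path)
      ; step  = λ i → R⇒Adj (Path-step path i)
      ; close = R⇒Adj closing
      }
    within : ∀ {u v} → OnCycle c u v → R u v
    within (inj₁ (i , inj₁ (refl , refl))) = Path-step path i
    within (inj₁ (i , inj₂ (refl , refl))) = R-sym (Path-step path i)
    within (inj₂ (inj₁ (refl , refl))) = closing
    within (inj₂ (inj₂ (refl , refl))) = R-sym closing
    on : ∀ {u v} → Consecutive (x ∷ y ∷ z ∷ r) u v → OnCycle c u v
    on k with Consecutive-lookup k
    ... | i , e , f = inj₁ (i , inj₁ (sym e , sym f))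

-- Ear decompositions

module _ {n : ℕ} (G : Graph n) where

  private
    V = Fin n

  Inside : List V → V → V → Set
  Inside T x y = Adj G x y × x ∈ T × y ∈ T

  ConnectedOn : List V → Set
  ConnectedOn T = ∀ {x y} → x ∈ T → y ∈ T → Star (Inside T) x y

  Biconnected : List V → Set
  Biconnected B = ConnectedOn B × (∀ {a T} → B ↭ a ∷ T → ConnectedOn T)

  Adj? : ∀ x y → Dec (Adj G x y)
  Adj? x y = adj G x y ≟ᵇ true

  open DecMembership (_≟ᶠ_ {n}) using (_∈?_)

  Joins-sym : ∀ {L : List (V × V)} {x y} → Joins L x y → Joins L y x
  Joins-sym = ⊎-swap

  Joins-there : ∀ {L : List (V × V)} {e x y} → Joins L x y → Joins (e ∷ L) x y
  Joins-there = ⊎-map there there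

  Joins? : ∀ (L : List (V × V)) x y → Dec (Joins L x y)
  Joins? L x y = ((x , y) ∈ₑ? L) ⊎-dec ((y , x) ∈ₑ? L)
    where open DecMembership (≡-dec (_≟ᶠ_ {n}) (_≟ᶠ_ {n})) renaming (_∈?_ to _∈ₑ?_)

  module EarDecomposition
    (cactus : EdgesInAtMostCycles 4 G)
    (B : List V) (B-unique : Unique B) (B-biconnected : Biconnected B)
    (p q : V) (p∈B : p ∈ B) (q∈B : q ∈ B) (p~q : Adj G p q)
    where

    -- A subgraph obtained from the edge pq by adding t ears: W lists its vertices in the order from p to q, L its edges.
    record Ears (t : ℕ) : Set where
      field
        W        : List V
        L        : List (V × V)
        W⊆B      : ∀ {x} → x ∈ W → x ∈ B
        W-unique : Unique W
        p∈W      : p ∈ W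
        q∈W      : q ∈ W
        L⇒Adj    : ∀ {x y} → Joins L x y → Adj G x y
        L⊆W      : ∀ {x y} → Joins L x y → x ∈ W
        p-q      : Joins L p q
        ascent   : ClimbsTo (Joins L) q W
        descent  : ClimbsTo (Joins L) p (W ʳ++ [])
        size     : suc (length L) ≤ length W + t
        cs       : Fin t → Cycle G
        through  : ∀ i → OnCycle (cs i) p q
        within   : ∀ i {x y} → OnCycle (cs i) x y → Joins L x y
        distinct : ∀ {i j} → i ≢ j → ¬ SameCycle (cs i) (cs j)

    start : Ears 0
    start = record
      { W = p ∷ q ∷ [] ; L = [ p , q ]
      ; W⊆B = λ { (here refl) → p∈B ; (there (here refl)) → q∈B }
      ; W-unique = (Adj-irrefl G p~q ∷ []) ∷ [] ∷ []
      ; p∈W = here refl ; q∈W = there (here refl)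
      ; L⇒Adj = λ { (inj₁ (here refl)) → p~q ; (inj₂ (here refl)) → Adj-sym G p~q }
      ; L⊆W = λ { (inj₁ (here refl)) → here refl ; (inj₂ (here refl)) → there (here refl) }
      ; p-q = inj₁ (here refl)
      ; ascent = climbs (inj₂ (here (inj₁ (here refl))) , inj₁ refl , tt) refl
      ; descent = climbs (inj₂ (here (inj₂ (here refl))) , inj₁ refl , tt) refl
      ; size = ≤-refl
      ; cs = λ () ; through = λ () ; within = λ () ; distinct = λ { {()} }
      }

    five-ears : ¬ Ears 5
    five-ears s with cactus p q p~q (Ears.cs s) (Ears.through s)
    ... | i , j , i≢j , same = Ears.distinct s i≢j same

    module _ {t} (s : Ears t) where
      open Ears s

      -- The ear joins a to the part C of the order above a; its interior xs is inserted between a and C.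
      attach : ∀ A a C xs L′ y → W ≡ (A ++ [ a ]) ++ C →
        Unique xs → (∀ {x} → x ∈ xs → x ∈ B × x ∉ W) →
        (∀ {x z} → Joins L x z → Joins L′ x z) → (∀ {x z} → Joins L′ x z → Adj G x z) →
        (∀ {x z} → Joins L′ x z → x ∈ W ⊎ x ∈ xs) →
        length L′ ≡ suc (length xs + length L) →
        (Up (Joins L′) C → Up (Joins L′) (xs ++ C)) → (∀ T → Up (Joins L′) (a ∷ T) → Up (Joins L′) (xs ʳ++ (a ∷ T))) →
        (∃ λ b → b ∈ C) → y ∈ xs ++ C → Joins L′ a y → ¬ Joins L a y → Ears (suc t)
      attach A a []         xs L′ y eq xs-unique xs-new L⊆L′ L′⇒Adj L′⊆ len upF upB (_ , ()) y∈ a-y a≁y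
      attach A a C@(c ∷ C′) xs L′ y refl xs-unique xs-new L⊆L′ L′⇒Adj L′⊆ len upF upB _ y∈ a-y a≁y = record
        { W = W′ ; L = L′
        ; W⊆B = W′⊆B ; W-unique = W′-unique
        ; p∈W = W⊆W′ p∈W ; q∈W = W⊆W′ q∈W
        ; L⇒Adj = L′⇒Adj
        ; L⊆W = [ W⊆W′ , xs⊆W′ ]′ ∘ L′⊆
        ; p-q = L⊆L′ p-q
        ; ascent = ascent′ ; descent = descent′
        ; size = size′
        ; cs = newCycle Vector.∷ cs
        ; through = λ { zero → proj₂ (proj₂ (proj₂ new)) ; (suc i) → through i }
        ; within = λ { zero → proj₁ (proj₂ new) ; (suc i) → L⊆L′ ∘ within i }
        ; distinct = distinct′
        }
        where
        X = A ++ [ a ]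
        W′ = X ++ xs ++ C
        R = Joins L′

        σ : W′ ↭ xs ++ W
        σ = shifts X xs

        W⊆W′ : ∀ {x} → x ∈ W → x ∈ W′
        W⊆W′ i = ∈-resp-↭ (↭-sym σ) (∈-++⁺ʳ xs i)
        xs⊆W′ : ∀ {x} → x ∈ xs → x ∈ W′
        xs⊆W′ i = ∈-resp-↭ (↭-sym σ) (∈-++⁺ˡ i)
        W′⊆B : ∀ {x} → x ∈ W′ → x ∈ B
        W′⊆B i with ∈-++⁻ xs (∈-resp-↭ σ i)
        ... | inj₁ j = proj₁ (xs-new j)
        ... | inj₂ j = W⊆B j
        W′-unique : Unique W′
        W′-unique = Unique-resp-↭ (↭-sym σ) (Unique.++⁺ xs-unique W-unique λ { (i , j) → proj₂ (xs-new i) j })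

        -- The ear brings one edge more than it brings vertices; the step from `t` to `suc t` pays
        -- for it.
        size′ : suc (length L′) ≤ length W′ + suc t
        size′ rewrite len | +-suc (length W′) t | ↭-length σ | length-++ xs {W} | +-assoc (length xs) (length W) t =
          s≤s (≤-trans (≤-reflexive (sym (+-suc (length xs) (length L)))) (+-monoʳ-≤ (length xs) size))

        back : X ʳ++ [] ≡ a ∷ (A ʳ++ [])
        back = ++-ʳ++ A

        ascent₀ = ClimbsTo-mono L⊆L′ ascent
        ascent′ : ClimbsTo R q W′
        ascent′ = ClimbsTo-insert X xs c C′ ascent₀ (upF (Up-++⁻ʳ X (ClimbsTo.up ascent₀)))

        descent₀ : ClimbsTo R p (reverse C ++ a ∷ (A ʳ++ []))
        descent₀ = subst (ClimbsTo R p) (trans (++-ʳ++ X) (trans (ʳ++-defn C) (cong (reverse C ++_) back)))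
                     (ClimbsTo-mono L⊆L′ descent)
        down-a : Up R (a ∷ (A ʳ++ []))
        down-a = Up-++⁻ʳ (reverse C) (ClimbsTo.up descent₀)
        -- Read from `q`, the interior is inserted between the reverse of `C` and `a`, so the same
        -- insertion lemma applies with a tail that starts at `a`.
        descent′ : ClimbsTo R p (W′ ʳ++ [])
        descent′ = subst (ClimbsTo R p) (sym unfold)
          (ClimbsTo-insert (reverse C) (reverse xs) a (A ʳ++ []) descent₀ (subst (Up R) (ʳ++-defn xs) (upB _ down-a)))
          where
          unfold : W′ ʳ++ [] ≡ reverse C ++ reverse xs ++ a ∷ (A ʳ++ [])
          unfold = trans (++-ʳ++ X) (trans (++-ʳ++ xs) (trans (ʳ++-defn C) (cong (reverse C ++_)
                     (trans (ʳ++-defn xs) (cong (reverse xs ++_) back)))))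

        Y = xs ++ C
        W′-split : W′ ≡ A ++ a ∷ Y
        W′-split = ++-assoc A [ a ] Y
        split-unique : Unique (A ++ a ∷ Y)
        split-unique = subst Unique W′-split W′-unique

        back-unique : Unique ((a ∷ Y) ʳ++ (A ʳ++ []))
        back-unique = subst Unique (trans (cong (_ʳ++ []) W′-split) (++-ʳ++ A))
                        (Unique-resp-↭ (↭-sym (↭-reverse W′)) W′-unique)

        rear-unique : Unique (a ∷ (A ʳ++ []))
        rear-unique = Unique-++⁻ʳ (reverse Y) (subst Unique (ʳ++-defn Y) back-unique)
        front-unique : Unique (a ∷ Y)
        front-unique = Unique-++⁻ʳ A split-unique

        separate : ∀ {x} → x ∈ a ∷ Y → x ∉ A ʳ++ []
        separate {x} i j = Unique-++⇒disjoint A split-unique (∈-resp-↭ (↭-reverse A) j) i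

        -- The new path consists of a descent from `a` to `p` inside `A`, the edge from `a` to `y`,
        -- and a rise from `y` to `q` inside `xs ++ C`. These are disjoint stretches of the order,
        -- so the path is simple.
        rising = climb {P = y ≡_} q Y y∈ (upF (Up-++⁻ʳ X (ClimbsTo.up ascent₀))) (Unique-++⁻ʳ [ a ] front-unique)

        lastY : lastOr q Y ≡ q
        lastY = trans (lastOr-++-∷ q xs c C′) (trans (sym (lastOr-++-∷ q X c C′)) (ClimbsTo.ends ascent))

        joined : ∃ λ l → Path R a q l × Consecutive l a y × (∀ {w} → w ∈ l → w ∈ a ∷ Y)
        joined with rising
        ... | _ , y ∷ l , refl , path , l⊆ rewrite lastY with refl ← Path-first path =
          a ∷ y ∷ l , go a-y (Unique[x∷xs]⇒x∉xs front-unique ∘ l⊆) path , here ,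
          λ { (here e) → here e ; (there i) → there (l⊆ i) }

        full : ∃ λ l → Path R p q l × Consecutive l a y
        full with joined | down-a | rear-unique
             | trans (sym (lastOr-++-∷ p (reverse C) a (A ʳ++ []))) (ClimbsTo.ends descent₀) | separate
        ... | l , path , k , l⊆ | st , u | h ∷ un | e | sep with A ʳ++ []
        -- With nothing before `a` in the order, `a` is `p`.
        ...   | [] rewrite e = l , path , k
        ...   | acc@(_ ∷ _) with st
        ...     | inj₂ r with prepend {R = R} Joins-sym a acc r u un path (sep ∘ l⊆)
        ...       | l′ , path′ , k′ rewrite e = l′ , path′ , k′ k

        -- The pair `p`, `q` is joined in `L` and `a`, `y` is not, so the path is not the edge from
        -- `p` to `q` itself.
        new = closePath G {R = R} Joins-sym L′⇒Adj (proj₁ (proj₂ full))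
                (Path-long (proj₁ (proj₂ full)) (proj₂ (proj₂ full)) λ { (refl , refl) → a≁y p-q }) (L⊆L′ p-q)
        newCycle : Cycle G
        newCycle = proj₁ new

        differs : ∀ i → OnCycle (cs i) a y → ⊥
        differs i = a≁y ∘ within i
        a-y∈new : OnCycle newCycle a y
        a-y∈new = proj₁ (proj₂ (proj₂ new)) (proj₂ (proj₂ full))

        distinct′ : ∀ {i j} → i ≢ j → ¬ SameCycle ((newCycle Vector.∷ cs) i) ((newCycle Vector.∷ cs) j)
        distinct′ {zero}  {zero}  i≢j same = i≢j refl
        distinct′ {zero}  {suc j} i≢j same = differs j (proj₁ (same a y) a-y∈new)
        distinct′ {suc i} {zero}  i≢j same = differs i (proj₂ (same a y) a-y∈new)
        distinct′ {suc i} {suc j} i≢j same = distinct (i≢j ∘ cong suc) same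

      chordUp : ∀ A a C {y} → W ≡ A ++ a ∷ C → a ∈ W → y ∈ W → y ∈ C → Adj G a y → ¬ Joins L a y → Ears (suc t)
      chordUp A a C {y} W≡ a∈ y∈ y∈C a~y a≁y =
        attach A a C [] ((a , y) ∷ L) y (trans W≡ (sym (++-assoc A [ a ] C))) [] (λ ())
          Joins-there
          (λ { (inj₁ (here refl)) → a~y ; (inj₂ (here refl)) → Adj-sym G a~y
             ; (inj₁ (there i)) → L⇒Adj (inj₁ i) ; (inj₂ (there i)) → L⇒Adj (inj₂ i) })
          (λ { (inj₁ (here refl)) → inj₁ a∈ ; (inj₂ (here refl)) → inj₁ y∈
             ; (inj₁ (there i)) → inj₁ (L⊆W (inj₁ i)) ; (inj₂ (there i)) → inj₁ (L⊆W (inj₂ i)) })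
          refl id (λ _ → id) (y , y∈C) y∈C (inj₁ (here refl)) a≁y

      -- Only the orientation is at stake: the chord has to start at whichever end comes first in
      -- `W`.
      chord : ∀ {u v} → u ∈ W → v ∈ W → Adj G u v → ¬ Joins L u v → Ears (suc t)
      chord {u} {v} u∈ v∈ u~v u≁v with ∈-∃++ u∈
      ... | A , C , W≡ with ∈-++⁻ A (subst (v ∈_) W≡ v∈)
      ...   | inj₂ (here refl) = contradiction refl (Adj-irrefl G u~v)
      ...   | inj₂ (there v∈C) = chordUp A u C W≡ u∈ v∈ v∈C u~v u≁v
      ...   | inj₁ v∈A with ∈-∃++ v∈A
      ...     | A₁ , A₂ , refl = chordUp A₁ v (A₂ ++ u ∷ C) (trans W≡ (++-assoc A₁ (v ∷ A₂) (u ∷ C))) v∈ u∈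
                (∈-++⁺ʳ A₂ (here refl)) (Adj-sym G u~v) (u≁v ∘ Joins-sym)

    -- The list holds the interior only, from `v` to the neighbour of the landing vertex `b`. The
    -- edge from `a` to `v` is added when the ear is attached.
    data Ear (W : List V) (a : V) : V → List V → Set where
      tip  : ∀ {v b} → v ∈ B → v ∉ W → Adj G v b → b ∈ W → b ≢ a → Ear W a v [ v ]
      cons : ∀ {v w xs} → v ∈ B → v ∉ W → v ∉ xs → Adj G v w → Ear W a w xs → Ear W a v (v ∷ xs)

    module _ {W : List V} {a : V} where

      earEdges : ∀ {v xs} → Ear W a v xs → List (V × V)
      earEdges (tip {v} {b} _ _ _ _ _)  = [ v , b ]
      earEdges (cons {v} {w} _ _ _ _ e) = (v , w) ∷ earEdges e

      length-earEdges : ∀ {v xs} (e : Ear W a v xs) → length (earEdges e) ≡ length xs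
      length-earEdges (tip _ _ _ _ _)  = refl
      length-earEdges (cons _ _ _ _ e) = cong suc (length-earEdges e)

      Ear-head : ∀ {v xs} → Ear W a v xs → v ∈ xs
      Ear-head (tip _ _ _ _ _)  = here refl
      Ear-head (cons _ _ _ _ e) = here refl

      Ear-unique : ∀ {v xs} → Ear W a v xs → Unique xs
      Ear-unique (tip _ _ _ _ _)  = [] ∷ []
      Ear-unique (cons _ _ h _ e) = ¬Any⇒All¬ _ h ∷ Ear-unique e

      Ear-new : ∀ {v xs} → Ear W a v xs → ∀ {x} → x ∈ xs → x ∈ B × x ∉ W
      Ear-new (tip i j _ _ _)  (here refl) = i , j
      Ear-new (cons i j _ _ e) (here refl) = i , j
      Ear-new (cons i j _ _ e) (there k)   = Ear-new e k

      Ear-suffix : ∀ {v xs} → Ear W a v xs → ∀ {x} → x ∈ xs → ∃ λ ys → Ear W a x ys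
      Ear-suffix e@(tip _ _ _ _ _)  (here refl) = _ , e
      Ear-suffix e@(cons _ _ _ _ _) (here refl) = _ , e
      Ear-suffix (cons _ _ _ _ e)   (there k)   = Ear-suffix e k

      earEdges-Adj : ∀ {v xs} (e : Ear W a v xs) → ∀ {x y} → (x , y) ∈ earEdges e → Adj G x y
      earEdges-Adj (tip _ _ r _ _)  (here refl) = r
      earEdges-Adj (cons _ _ _ r e) (here refl) = r
      earEdges-Adj (cons _ _ _ _ e) (there k)   = earEdges-Adj e k

      earEdges-source : ∀ {v xs} (e : Ear W a v xs) → ∀ {x y} → (x , y) ∈ earEdges e → x ∈ xs
      earEdges-source (tip _ _ _ _ _)  (here refl) = here refl
      earEdges-source (cons _ _ _ _ e) (here refl) = here refl
      earEdges-source (cons _ _ _ _ e) (there k)   = there (earEdges-source e k)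

      earEdges-target : ∀ {v xs} (e : Ear W a v xs) → ∀ {x y} → (x , y) ∈ earEdges e → y ∈ W ⊎ y ∈ xs
      earEdges-target (tip _ _ _ b∈ _) (here refl) = inj₁ b∈
      earEdges-target (cons _ _ _ _ e) (here refl) = inj₂ (there (Ear-head e))
      earEdges-target (cons _ _ _ _ e) (there k)   = ⊎-map id there (earEdges-target e k)

      Ear-up : ∀ {R : V → V → Set} {C v xs} (e : Ear W a v xs) → (∀ {x y} → (x , y) ∈ earEdges e → R x y) →
        (∀ {x b} → x ∈ B → x ∉ W → Adj G x b → b ∈ W → b ≢ a → b ∈ C) → Up R C → Up R (xs ++ C)
      Ear-up (tip i j r b∈ b≢) R∋ land u = inj₂ (Any.map (λ { refl → R∋ (here refl) }) (land i j r b∈ b≢)) , u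
      Ear-up (cons _ _ _ _ e) R∋ land u =
        inj₂ (Any-++⁺ˡ (Any.map (λ { refl → R∋ (here refl) }) (Ear-head e))) , Ear-up e (R∋ ∘ there) land u

      Ear-down : ∀ {R : V → V → Set} {v xs} (e : Ear W a v xs) → (∀ {x y} → (x , y) ∈ earEdges e → R y x) →
        ∀ T → Any (R v) T → Up R T → Up R (xs ʳ++ T)
      Ear-down (tip _ _ _ _ _)      R∋ T r u = inj₂ r , u
      Ear-down (cons {v} _ _ _ _ e) R∋ T r u = Ear-down e (R∋ ∘ there) (v ∷ T) (here (R∋ (here refl))) (inj₂ r , u)

      -- The walk is cut at its first vertex in `W` and its loops are erased: if `v` recurs on the
      -- ear found for the rest, only the part from that occurrence on is kept. Since `T` omits `a`,
      -- the landing vertex is not `a`.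
      findEar : ∀ {T v t} → (∀ {x} → x ∈ T → x ∈ B × x ≢ a) → Star (Inside T) v t → v ∈ B → v ∉ W → t ∈ W →
        ∃ λ xs → Ear W a v xs
      findEar T⊆ ε v∈ v∉ t∈ = contradiction t∈ v∉
      findEar {v = v} T⊆ (_◅_ {j = w} (v~w , _ , w∈T) ρ) v∈ v∉ t∈ with w ∈? W
      ... | yes w∈ = _ , tip v∈ v∉ v~w w∈ (proj₂ (T⊆ w∈T))
      ... | no w∉ with findEar T⊆ ρ (proj₁ (T⊆ w∈T)) w∉ t∈
      ...   | xs , e with v ∈? xs
      ...     | yes v∈xs = Ear-suffix e v∈xs
      ...     | no v∉xs  = _ , cons v∈ v∉ v∉xs v~w e

    module _ {t} (s : Ears t) where
      open Ears s

      Exit : V → Set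
      Exit x = Any (λ v → v ∉ W × Adj G x v) B

      Exit? : ∀ x → Dec (Exit x)
      Exit? x = any? (λ v → ¬? (v ∈? W) ×-dec Adj? x v) B

      -- Since a is the first vertex of the order with a neighbour outside W, an ear leaving W at a returns above a.
      properEar : ∀ A a C → W ≡ (A ++ [ a ]) ++ C → Exit a → All (¬_ ∘ Exit) A → Ears (suc t)
      properEar A a C W≡ exit none with find exit
      ... | v , v∈ , v∉ , a~v = build
        where
        a∈W : a ∈ W
        a∈W = subst (a ∈_) (sym W≡) (∈-++⁺ˡ (∈-++⁺ʳ A (here refl)))

        land : ∀ {x b} → x ∈ B → x ∉ W → Adj G x b → b ∈ W → b ≢ a → b ∈ C
        land {x} {b} x∈ x∉ x~b b∈ b≢a with ∈-++⁻ (A ++ [ a ]) (subst (b ∈_) W≡ b∈)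
        ... | inj₂ k = k
        ... | inj₁ k with ∈-++⁻ A k
        ...   | inj₂ (here refl) = contradiction refl b≢a
        ...   | inj₁ k′ = contradiction (Any.map (λ { refl → x∉ , Adj-sym G x~b }) x∈) (All.lookup none k′)

        -- A goal in `W` for a walk that avoids `a`; biconnectivity supplies the walk, and one of
        -- `p` and `q` always serves as the goal.
        other : ∃ λ b → b ∈ W × b ≢ a
        other with p ≟ᶠ a
        ... | no p≢a   = p , p∈W , p≢a
        ... | yes refl = q , q∈W , Adj-irrefl G p~q ∘ sym

        ear : ∃ λ xs → Ear W a v xs
        ear with ∈-∃++ (W⊆B a∈W)
        ... | B₁ , B₂ , B≡ = findEar T⊆ (proj₂ B-biconnected σ v∈T (keep (W⊆B b∈) b≢a)) v∈ v∉ b∈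
          where
          b∈ = proj₁ (proj₂ other)
          b≢a = proj₂ (proj₂ other)
          σ : B ↭ a ∷ (B₁ ++ B₂)
          σ = subst (_↭ a ∷ (B₁ ++ B₂)) (sym B≡) (shift a B₁ B₂)
          keep : ∀ {x} → x ∈ B → x ≢ a → x ∈ B₁ ++ B₂
          keep x∈ x≢a with ∈-resp-↭ σ x∈
          ... | here refl = contradiction refl x≢a
          ... | there k   = k
          v∈T = keep v∈ λ { refl → v∉ a∈W }
          T⊆ : ∀ {x} → x ∈ B₁ ++ B₂ → x ∈ B × x ≢ a
          T⊆ k = ∈-resp-↭ (↭-sym σ) (there k) , λ { refl → Unique[x∷xs]⇒x∉xs (Unique-resp-↭ σ B-unique) k }

        build : Ears (suc t)
        build with ear
        ... | xs , e = attach s A a C xs L′ v W≡ (Ear-unique e) (Ear-new e)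
          L⊆L′ L′⇒Adj L′⊆
          (cong suc (trans (length-++ (earEdges e)) (cong (_+ length L) (length-earEdges e))))
          (Ear-up e (λ k → inj₁ (there (∈-++⁺ˡ k))) land)
          (λ T → Ear-down e (λ k → inj₂ (there (∈-++⁺ˡ k))) (a ∷ T) (here (inj₂ (here refl))))
          (Ear-lands e) (∈-++⁺ˡ (Ear-head e)) (inj₁ (here refl)) (v∉ ∘ L⊆W ∘ Joins-sym)
          where
          L′ = (a , v) ∷ earEdges e ++ L
          L⊆L′ : ∀ {x z} → Joins L x z → Joins L′ x z
          L⊆L′ = ⊎-map (there ∘ ∈-++⁺ʳ (earEdges e)) (there ∘ ∈-++⁺ʳ (earEdges e))
          L′⇒Adj : ∀ {x z} → Joins L′ x z → Adj G x z
          L′⇒Adj (inj₁ (here refl)) = a~v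
          L′⇒Adj (inj₂ (here refl)) = Adj-sym G a~v
          L′⇒Adj (inj₁ (there k)) = [ earEdges-Adj e , L⇒Adj ∘ inj₁ ]′ (∈-++⁻ (earEdges e) k)
          L′⇒Adj (inj₂ (there k)) = [ Adj-sym G ∘ earEdges-Adj e , L⇒Adj ∘ inj₂ ]′ (∈-++⁻ (earEdges e) k)
          L′⊆ : ∀ {x z} → Joins L′ x z → x ∈ W ⊎ x ∈ xs
          L′⊆ (inj₁ (here refl)) = inj₁ a∈W
          L′⊆ (inj₂ (here refl)) = inj₂ (Ear-head e)
          L′⊆ (inj₁ (there k)) = [ inj₂ ∘ earEdges-source e , inj₁ ∘ L⊆W ∘ inj₁ ]′ (∈-++⁻ (earEdges e) k)
          L′⊆ (inj₂ (there k)) = [ earEdges-target e , inj₁ ∘ L⊆W ∘ inj₂ ]′ (∈-++⁻ (earEdges e) k)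
          Ear-lands : ∀ {v xs} → Ear W a v xs → ∃ λ b → b ∈ C
          Ear-lands (tip i j r b∈ b≢) = _ , land i j r b∈ b≢
          Ear-lands (cons _ _ _ _ e)  = Ear-lands e

      closed⇒spanning : All (¬_ ∘ Exit) W → ∀ {x} → x ∈ B → x ∈ W
      closed⇒spanning none x∈ = follow p∈W (proj₁ B-biconnected p∈B x∈)
        where
        follow : ∀ {x y} → x ∈ W → Star (Inside B) x y → y ∈ W
        follow x∈ ε = x∈
        follow x∈ (_◅_ {j = y} (x~y , _ , y∈B) ρ) with y ∈? W
        ... | yes y∈ = follow y∈ ρ
        ... | no y∉  = contradiction (Any.map (λ { refl → y∉ , x~y }) y∈B) (All.lookup none x∈)

      spanning-bound : t ≤ 4 → (∀ {x} → x ∈ B → x ∈ W) → (∀ {x y} → x ∈ W → y ∈ W → Adj G x y → Joins L x y) →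
        pairs (adj G) B ≤ 3 + length B
      spanning-bound t≤4 B⊆W Adj⇒L = begin
        pairs (adj G) B   ≤⟨ pairs-mono B (λ x∈ y∈ r → Joins⇒joinsᵇ L (Adj⇒L (B⊆W x∈) (B⊆W y∈) r)) ⟩
        pairs (joinsᵇ L) B ≤⟨ pairs-joinsᵇ L (All.tabulate λ k → Adj-irrefl G (L⇒Adj (inj₁ k))) B-unique ⟩
        length L          ≤⟨ s≤s⁻¹ (≤-trans size (≤-trans (+-mono-≤ (unique-length-≤ W-unique W⊆B) t≤4)
                                 (≤-reflexive (+-comm (length B) 4)))) ⟩
        3 + length B      ∎
        where open ≤-Reasoning

      -- A subgraph that no ear can leave and that lacks no chord is all of `B`, so its edge list
      -- bounds the edges of `B`.
      step-or-bound : t ≤ 4 → pairs (adj G) B ≤ 3 + length B ⊎ Ears (suc t)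
      step-or-bound t≤4 with splitFirst Exit? W
      ... | inj₁ (A , a , C , W≡ , exit , none) = inj₂ (properEar A a C W≡ exit none)
      ... | inj₂ none with any? (λ x → any? (λ y → Adj? x y ×-dec ¬? (Joins? L x y)) W) W
      ...   | yes i with find i
      ...     | u , u∈ , j with find j
      ...       | v , v∈ , u~v , u≁v = inj₂ (chord s u∈ v∈ u~v u≁v)
      step-or-bound t≤4 | inj₂ none | no ¬i = inj₁ (spanning-bound t≤4 (closed⇒spanning none) joined)
        where
        joined : ∀ {x y} → x ∈ W → y ∈ W → Adj G x y → Joins L x y
        joined {x} {y} x∈ y∈ r with Joins? L x y
        ... | yes j = j
        ... | no ¬j = contradiction (lose x∈ (lose y∈ (r , ¬j))) ¬i

    biconnected-bound : pairs (adj G) B ≤ 3 + length B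
    -- The counter `k` is the number of ears still missing from five, and five are impossible.
    biconnected-bound = run 5 start refl
      where
      run : ∀ k {t} → Ears t → k + t ≡ 5 → pairs (adj G) B ≤ 3 + length B
      run zero    s refl = contradiction s five-ears
      run (suc k) {t} s eq with step-or-bound s (≤-trans (m≤n+m t k) (≤-reflexive (suc-injective eq)))
      ... | inj₁ bound = bound
      ... | inj₂ s′    = run k s′ (trans (+-suc k t) eq)

-- Five vertices

-- Non-edges may become edges: a sparse pattern has to be found inside denser graphs.
record Embedding {k n} (H : Graph k) (G : Graph n) : Set where
  field
    image     : Fin k → Fin n
    injective : Injective _≡_ _≡_ image
    edges     : ∀ x y → Adj H x y → Adj G (image x) (image y)

module _ {k n} {H : Graph k} {G : Graph n} (f : Embedding H G) where
  open Embedding f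

  mapCycle : Cycle H → Cycle G
  mapCycle c = record
    { m     = m c
    ; vtx   = image ∘ vtx c
    ; inj   = inj c ∘ injective
    ; step  = λ i → edges _ _ (step c i)
    ; close = edges _ _ (close c)
    }

  SameEdge-map : ∀ {a b u v} → SameEdge a b u v → SameEdge (image a) (image b) (image u) (image v)
  SameEdge-map (inj₁ (refl , refl)) = inj₁ (refl , refl)
  SameEdge-map (inj₂ (refl , refl)) = inj₂ (refl , refl)

  SameEdge-unmap : ∀ {a b u v} → SameEdge (image a) (image b) (image u) (image v) → SameEdge a b u v
  SameEdge-unmap (inj₁ (p , q)) = inj₁ (injective p , injective q)
  SameEdge-unmap (inj₂ (p , q)) = inj₂ (injective p , injective q)

  OnCycle-map : ∀ c {u v} → OnCycle c u v → OnCycle (mapCycle c) (image u) (image v)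
  OnCycle-map c (inj₁ (i , s)) = inj₁ (i , SameEdge-map s)
  OnCycle-map c (inj₂ s)       = inj₂ (SameEdge-map s)

  OnCycle-unmap : ∀ c {u v} → OnCycle (mapCycle c) (image u) (image v) → OnCycle c u v
  OnCycle-unmap c (inj₁ (i , s)) = inj₁ (i , SameEdge-unmap s)
  OnCycle-unmap c (inj₂ s)       = inj₂ (SameEdge-unmap s)

  restrict : ∀ {t} → EdgesInAtMostCycles t G → EdgesInAtMostCycles t H
  restrict cactus u v u~v cs on with cactus _ _ (edges u v u~v) (mapCycle ∘ cs) (λ i → OnCycle-map (cs i) (on i))
  ... | i , j , i≢j , same = i , j , i≢j , λ x y →
    (OnCycle-unmap (cs j) ∘ proj₁ (same _ _) ∘ OnCycle-map (cs i)) ,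
    (OnCycle-unmap (cs i) ∘ proj₂ (same _ _) ∘ OnCycle-map (cs j))

pullback : ∀ {k n} → (Fin k → Fin n) → Graph n → Graph k
pullback f G = record
  { adj    = λ x y → adj G (f x) (f y)
  ; symm   = λ x y → symm G (f x) (f y)
  ; irrefl = λ x → irrefl G (f x)
  }

SameEdge? : ∀ {n} (a b u v : Fin n) → Dec (SameEdge a b u v)
SameEdge? a b u v = (u ≟ᶠ a ×-dec v ≟ᶠ b) ⊎-dec (u ≟ᶠ b ×-dec v ≟ᶠ a)

-- OnCycle c is by definition OnSeq (vtx c).
OnSeq : ∀ {n k} → (Fin (suc k) → Fin n) → Fin n → Fin n → Set
OnSeq {k = k} f u v = (Σ (Fin k) λ i → SameEdge (f (inject₁ i)) (f (suc i)) u v) ⊎ SameEdge (f (fromℕ k)) (f zero) u v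

OnSeq? : ∀ {n k} (f : Fin (suc k) → Fin n) u v → Dec (OnSeq f u v)
OnSeq? {k = k} f u v = anyFin? (λ i → SameEdge? (f (inject₁ i)) (f (suc i)) u v) ⊎-dec SameEdge? (f (fromℕ k)) (f zero) u v

module _ {n} {G : Graph n} where

  OnCycle? : ∀ (c : Cycle G) u v → Dec (OnCycle c u v)
  OnCycle? c = OnSeq? (vtx c)

  SameCycle? : ∀ (c d : Cycle G) → Dec (SameCycle c d)
  SameCycle? c d = all? λ u → all? λ v →
    (OnCycle? c u v →-dec OnCycle? d u v) ×-dec (OnCycle? d u v →-dec OnCycle? c u v)

Injective? : ∀ {k n} (f : Fin k → Fin n) → Dec (∀ x y → f x ≡ f y → x ≡ y)
Injective? f = all? λ x → all? λ y → (f x ≟ᶠ f y) →-dec (x ≟ᶠ y)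

module _ {n} (G : Graph n) where

  IsCycle? : ∀ {m} (v : Vec (Fin n) (3 + m)) → Dec
    ((∀ x y → Vec.lookup v x ≡ Vec.lookup v y → x ≡ y)
     × (∀ i → Adj G (Vec.lookup v (inject₁ i)) (Vec.lookup v (suc i)))
     × Adj G (Vec.lookup v (fromℕ (2 + m))) (Vec.lookup v zero))
  IsCycle? {m} v = Injective? (Vec.lookup v) ×-dec
    (all? λ i → Adj? G (Vec.lookup v (inject₁ i)) (Vec.lookup v (suc i))) ×-dec
    Adj? G (Vec.lookup v (fromℕ (2 + m))) (Vec.lookup v zero)

  cycle : ∀ {m} (v : Vec (Fin n) (3 + m)) {_ : True (IsCycle? v)} → Cycle G
  cycle {m} v {ok} = record
    { m     = m
    ; vtx   = Vec.lookup v
    ; inj   = proj₁ (toWitness ok) _ _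
    ; step  = proj₁ (proj₂ (toWitness ok))
    ; close = proj₂ (proj₂ (toWitness ok))
    }

without : List (Fin 5 × Fin 5) → Fin 5 → Fin 5 → Bool
without L x y = not (⌊ x ≟ᶠ y ⌋ ∨ joinsᵇ L x y)

graph : ∀ {n} (a : Fin n → Fin n → Bool) {_ : True (all? λ u → all? λ v → a u v ≟ᵇ a v u)}
  {_ : True (all? λ u → a u u ≟ᵇ false)} → Graph n
graph a {s} {i} = record { adj = a ; symm = toWitness s ; irrefl = toWitness i }

-- K₅ without two edges: the missing edges form a path or a matching.
K₅-path : Graph 5
K₅-path = graph (without ((0F , 1F) ∷ (0F , 2F) ∷ []))

K₅-matching : Graph 5
K₅-matching = graph (without ((0F , 1F) ∷ (2F , 3F) ∷ []))

module _ {n} {G : Graph n} where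

  allThrough? : ∀ {t} (cs : Vec (Cycle G) t) u v → Dec (∀ i → OnCycle (Vec.lookup cs i) u v)
  allThrough? cs u v = all? λ i → OnCycle? (Vec.lookup cs i) u v

  allDistinct? : ∀ {t} (cs : Vec (Cycle G) t) → Dec (∀ i j → SameCycle (Vec.lookup cs i) (Vec.lookup cs j) → i ≡ j)
  allDistinct? cs = all? λ i → all? λ j → SameCycle? (Vec.lookup cs i) (Vec.lookup cs j) →-dec (i ≟ᶠ j)

  excessCycles : ∀ {k} u v → Adj G u v → (cs : Vec (Cycle G) (suc k)) →
    (∀ i → OnCycle (Vec.lookup cs i) u v) → (∀ i j → SameCycle (Vec.lookup cs i) (Vec.lookup cs j) → i ≡ j) →
    ¬ EdgesInAtMostCycles k G
  excessCycles u v u~v cs on distinct cactus with cactus u v u~v (Vec.lookup cs) on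
  ... | i , j , i≢j , same = i≢j (distinct i j same)

abstract
  -- The only neighbours of 0 are 3 and 4, so the cycles through 0 and 3 correspond to the paths
  -- from 3 to 4 in the K₄ on 1, 2, 3, 4. There are 1 + 2 + 2 of these.
  K₅-path-not-cactus : ¬ EdgesInAtMostCycles 4 K₅-path
  K₅-path-not-cactus = excessCycles 0F 3F refl cs
      (toWitness {a? = allThrough? cs 0F 3F} tt) (toWitness {a? = allDistinct? cs} tt)
    where
    cs : Vec (Cycle K₅-path) 5
    cs = cycle K₅-path (0F ∷ 3F ∷ 4F ∷ [])
       ∷ cycle K₅-path (0F ∷ 3F ∷ 1F ∷ 4F ∷ [])
       ∷ cycle K₅-path (0F ∷ 3F ∷ 2F ∷ 4F ∷ [])
       ∷ cycle K₅-path (0F ∷ 3F ∷ 1F ∷ 2F ∷ 4F ∷ [])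
       ∷ cycle K₅-path (0F ∷ 3F ∷ 2F ∷ 1F ∷ 4F ∷ [])
       ∷ []

  -- Six paths other than the edge itself join 0 to 4; five of them are used.
  K₅-matching-not-cactus : ¬ EdgesInAtMostCycles 4 K₅-matching
  K₅-matching-not-cactus = excessCycles 0F 4F refl cs
      (toWitness {a? = allThrough? cs 0F 4F} tt) (toWitness {a? = allDistinct? cs} tt)
    where
    cs : Vec (Cycle K₅-matching) 5
    cs = cycle K₅-matching (4F ∷ 0F ∷ 2F ∷ [])
       ∷ cycle K₅-matching (4F ∷ 0F ∷ 3F ∷ [])
       ∷ cycle K₅-matching (4F ∷ 0F ∷ 2F ∷ 1F ∷ [])
       ∷ cycle K₅-matching (4F ∷ 0F ∷ 3F ∷ 1F ∷ [])
       ∷ cycle K₅-matching (4F ∷ 0F ∷ 2F ∷ 1F ∷ 3F ∷ [])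
       ∷ []

-- Graphs as finite data, one Boolean per pair of vertices. Adjacency functions are not enumerable
-- as such, whereas the 2^10 codes for five vertices are.
UpperTriangle : ℕ → Set
UpperTriangle zero    = ⊤
UpperTriangle (suc n) = Vec Bool n × UpperTriangle n

decode : ∀ {n} → UpperTriangle n → Fin n → Fin n → Bool
decode (r , t) zero    zero    = false
decode (r , t) zero    (suc j) = Vec.lookup r j
decode (r , t) (suc i) zero    = Vec.lookup r i
decode (r , t) (suc i) (suc j) = decode t i j

encode : ∀ {n} → Graph n → UpperTriangle n
encode {zero}  G = tt
encode {suc n} G = Vec.tabulate (λ j → adj G zero (suc j)) , encode (pullback suc G)

decode-encode : ∀ {n} (G : Graph n) i j → decode (encode G) i j ≡ adj G i j
decode-encode G zero    zero    = sym (irrefl G zero)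
decode-encode G zero    (suc j) = lookup∘tabulate _ j
decode-encode G (suc i) zero    = trans (lookup∘tabulate _ i) (symm G zero (suc i))
decode-encode G (suc i) (suc j) = decode-encode (pullback suc G) i j

∀Bool? : {P : Bool → Set} → (∀ b → Dec (P b)) → Dec (∀ b → P b)
∀Bool? P? = map′ (λ { (t , f) true → t ; (t , f) false → f }) (λ h → h true , h false) (P? true ×-dec P? false)

∀Vec? : ∀ {A : Set} → (∀ {P : A → Set} → (∀ a → Dec (P a)) → Dec (∀ a → P a)) →
  ∀ n {P : Vec A n → Set} → (∀ v → Dec (P v)) → Dec (∀ v → P v)
∀Vec? ∀A? zero    P? = map′ (λ { h [] → h }) (λ h → h []) (P? [])
∀Vec? ∀A? (suc n) P? = map′ (λ { h (a ∷ v) → h a v }) (λ h a v → h (a ∷ v)) (∀A? λ a → ∀Vec? ∀A? n λ v → P? (a ∷ v))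

∀UpperTriangle? : ∀ n {P : UpperTriangle n → Set} → (∀ t → Dec (P t)) → Dec (∀ t → P t)
∀UpperTriangle? zero    P? = map′ (λ { h tt → h }) (λ h → h tt) (P? tt)
∀UpperTriangle? (suc n) P? =
  map′ (λ { h (r , t) → h r t }) (λ h r t → h (r , t)) (∀Vec? ∀Bool? n λ r → ∀UpperTriangle? n λ t → P? (r , t))

insertions : ∀ {A : Set} {n} → A → Vec A n → List (Vec A (suc n))
insertions x []       = [ x ∷ [] ]
insertions x (y ∷ ys) = (x ∷ y ∷ ys) ∷ map (y ∷_) (insertions x ys)

permutations : ∀ {A : Set} {n} → Vec A n → List (Vec A n)
permutations []       = [ [] ]
permutations (x ∷ xs) = concatMap (insertions x) (permutations xs)

abstract
  permutations₅ : List (Vec (Fin 5) 5)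
  permutations₅ = permutations (0F ∷ 1F ∷ 2F ∷ 3F ∷ 4F ∷ [])

Maps : Graph 5 → (Fin 5 → Fin 5 → Bool) → Vec (Fin 5) 5 → Set
Maps H a σ = ∀ x y → Adj H x y → a (Vec.lookup σ x) (Vec.lookup σ y) ≡ true

Maps? : ∀ H a σ → Dec (Maps H a σ)
Maps? H a σ = all? λ x → all? λ y → Adj? H x y →-dec (a (Vec.lookup σ x) (Vec.lookup σ y) ≟ᵇ true)

-- With eight of the ten pairs present, at most two are missing, and `σ` moves them to the standard
-- position of a path or a matching.
Dense : (Fin 5 → Fin 5 → Bool) → Set
Dense a = 8 ≤ pairs a (allFin 5) → Any (λ σ → Maps K₅-path a σ ⊎ Maps K₅-matching a σ) permutations₅

Dense? : ∀ a → Dec (Dense a)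
Dense? a = (8 ≤? pairs a (allFin 5)) →-dec any? (λ σ → Maps? K₅-path a σ ⊎-dec Maps? K₅-matching a σ) permutations₅

abstract
  permutations₅-injective : All (λ σ → ∀ x y → Vec.lookup σ x ≡ Vec.lookup σ y → x ≡ y) permutations₅
  permutations₅-injective = toWitness {a? = All.all? (Injective? ∘ Vec.lookup) permutations₅} tt

  dense : ∀ t → Dense (decode t)
  dense = toWitness {a? = ∀UpperTriangle? 5 (Dense? ∘ decode)} tt

-- The upper bound

graph₅-bound : (H : Graph 5) → EdgesInAtMostCycles 4 H → pairs (adj H) (allFin 5) ≤ 7
graph₅-bound H cactus with 8 ≤? pairs (adj H) (allFin 5)
... | no 8≰    = s≤s⁻¹ (≰⇒> 8≰)
... | yes 8≤ with find (dense (encode H) (≤-trans 8≤ (pairs-mono (allFin 5) λ {x} {y} _ _ → trans (decode-encode H x y))))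
...   | σ , σ∈ , maps = contradiction maps [ K₅-path-not-cactus ∘ avoid , K₅-matching-not-cactus ∘ avoid ]′
  where
  avoid : ∀ {K} → Maps K (decode (encode H)) σ → EdgesInAtMostCycles 4 K
  avoid {K} h = restrict {H = K} {G = H} record
    { image     = Vec.lookup σ
    ; injective = All.lookup permutations₅-injective σ∈ _ _
    ; edges     = λ x y e → trans (sym (decode-encode H _ _)) (h x y e)
    } cactus

-- Remainders modulo 3 compute through three successors, so `Slack` has period 3 definitionally and
-- recursion in steps of three needs no rewriting.
Slack≤3 : ∀ n → Slack n ≤ 3
Slack≤3 0                   = ≤-refl
Slack≤3 1                   = n≤1+n 2
Slack≤3 2                   = ≤-refl
Slack≤3 (suc (suc (suc n))) = Slack≤3 n

2≤Slack : ∀ n → 2 ≤ Slack n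
2≤Slack 0                   = n≤1+n 2
2≤Slack 1                   = ≤-refl
2≤Slack 2                   = n≤1+n 2
2≤Slack (suc (suc (suc n))) = 2≤Slack n

-- The left side is at most 5, so only two sides of slack 2 are critical. Then 3 divides both `s`
-- and `r`, and the whole has slack 2 as well.
Slack-glue : ∀ s r → Slack (suc (s + r)) + 2 ≤ Slack (suc s) + Slack (suc r)
Slack-glue 0                   r = ≤-reflexive (+-comm (Slack (suc r)) 2)
Slack-glue 1                   r = +-mono-≤ (Slack≤3 (2 + r)) (2≤Slack (suc r))
Slack-glue 2                   r = +-mono-≤ (Slack≤3 r) (2≤Slack (suc r))
Slack-glue (suc (suc (suc s))) r = Slack-glue s r

-- Cut vertices and induction on the number of vertices

module _ {n : ℕ} (G : Graph n) where

  private
    V = Fin n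

  Inside-mono : ∀ {S T} → (∀ {x} → x ∈ S → x ∈ T) → ∀ {x y} → Star (Inside G S) x y → Star (Inside G T) x y
  Inside-mono S⊆T = Star.map λ (a , i , j) → a , S⊆T i , S⊆T j

  rooted⇒connected : ∀ {T r} → (∀ {x} → x ∈ T → Star (Inside G T) x r) → ConnectedOn G T
  rooted⇒connected to-root x∈ y∈ =
    to-root x∈ ◅◅ Star.reverse (λ (a , i , j) → Adj-sym G a , j , i) (to-root y∈)

  Separated : List V → List V → Set
  Separated S R = ∀ {x y} → x ∈ S → y ∈ R → adj G x y ≡ false

  Split : List V → Set
  Split T = ∃₂ λ S R → T ↭ S ++ R × 0 < length S × 0 < length R × Separated S R

  -- `S` is the part already linked to `v`. Either some edge leads from `S` into `R`, and its end
  -- moves over to `S`, or the two parts are separated.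
  growComponent : ∀ k {T v} S R → length R ≤ k → T ↭ S ++ R → v ∈ S →
    (∀ {x} → x ∈ S → Star (Inside G S) x v) → ConnectedOn G T ⊎ Split T
  growComponent k S [] _ σ v∈ reach = inj₁ λ x∈ y∈ →
    Inside-mono (∈-resp-↭ (↭-sym τ)) (rooted⇒connected reach (∈-resp-↭ τ x∈) (∈-resp-↭ τ y∈))
    where τ = ↭-trans σ (↭-reflexive (++-identityʳ S))
  growComponent (suc k) {v = v} S R@(_ ∷ _) R≤k σ v∈ reach with any? (λ x → any? (λ y → Adj? G x y) R) S
  ... | no none = inj₂ (S , R , σ , nonempty v∈ , s≤s z≤n , λ x∈ y∈ → ¬Adj λ a → none (lose x∈ (lose y∈ a)))
    where
    nonempty : ∀ {x} {xs : List V} → x ∈ xs → 0 < length xs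
    nonempty (here _)  = s≤s z≤n
    nonempty (there _) = s≤s z≤n
    ¬Adj : ∀ {x y} → ¬ Adj G x y → adj G x y ≡ false
    ¬Adj {x} {y} ¬a with adj G x y
    ... | true  = contradiction refl ¬a
    ... | false = refl
  ... | yes i with find i
  ...   | x , x∈ , j with find j
  ...     | y , y∈ , x~y with ∈-∃++ y∈
  ...       | R₁ , R₂ , R≡ = growComponent k (y ∷ S) (R₁ ++ R₂) shorter τ (there v∈) reach′
    where
    shorter : length (R₁ ++ R₂) ≤ k
    shorter = s≤s⁻¹ (≤-trans (≤-reflexive (trans (sym (↭-length (shift y R₁ R₂))) (sym (cong length R≡)))) R≤k)
    τ = ↭-trans σ (↭-trans (++⁺ˡ S (↭-trans (↭-reflexive R≡) (shift y R₁ R₂))) (shift y S (R₁ ++ R₂)))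
    reach′ : ∀ {z} → z ∈ y ∷ S → Star (Inside G (y ∷ S)) z v
    reach′ (here refl) = (Adj-sym G x~y , here refl , there x∈) ◅ Inside-mono there (reach x∈)
    reach′ (there z∈)  = Inside-mono there (reach z∈)

  connected⊎split : ∀ T → ConnectedOn G T ⊎ Split T
  connected⊎split []      = inj₁ λ ()
  connected⊎split (v ∷ T) = growComponent (length T) [ v ] T ≤-refl ↭-refl (here refl) λ { (here refl) → ε }

  -- No edge leads from `S` to `R`, so a walk from `S` to `a` stays in `S` until its first visit to
  -- `a`.
  side-connected : ∀ {U a S R} → ConnectedOn G U → U ↭ a ∷ S ++ R → Separated S R → ConnectedOn G (a ∷ S)
  side-connected {U} {a} {S} {R} conn σ sep =
    rooted⇒connected {r = a} λ
      { (here refl) → ε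
      ; (there x∈)  → walk x∈ (conn (∈-resp-↭ (↭-sym σ) (there (∈-++⁺ˡ x∈))) (∈-resp-↭ (↭-sym σ) (here refl))) }
    where
    walk : ∀ {x} → x ∈ S → Star (Inside G U) x a → Star (Inside G (a ∷ S)) x a
    walk x∈ ε = ε
    walk x∈ ((x~y , _ , y∈) ◅ ρ) with ∈-resp-↭ σ y∈
    ... | here refl = (x~y , there x∈ , here refl) ◅ ε
    ... | there y∈′ with ∈-++⁻ S y∈′
    ...   | inj₁ y∈S = (x~y , there x∈ , there y∈S) ◅ walk y∈S ρ
    ...   | inj₂ y∈R with () ← trans (sym x~y) (sep x∈ y∈R)

  Cut : List V → Set
  Cut U = ∃ λ a → ∃₂ λ S R → U ↭ a ∷ S ++ R × 0 < length S × 0 < length R × Separated S R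

  search : ∀ {P : Set} {Q : V → Set} xs → (∀ {x} → x ∈ xs → P ⊎ Q x) → P ⊎ (∀ {x} → x ∈ xs → Q x)
  search []       f = inj₂ λ ()
  search (x ∷ xs) f with f (here refl) | search xs (f ∘ there)
  ... | inj₁ p | _      = inj₁ p
  ... | inj₂ _ | inj₁ p = inj₁ p
  ... | inj₂ q | inj₂ g = inj₂ λ { (here refl) → q ; (there i) → g i }

  cut⊎biconnected : ∀ {U} → ConnectedOn G U → Cut U ⊎ Biconnected G U
  cut⊎biconnected {U} conn with search U examine
    where
    examine : ∀ {a} → a ∈ U → Cut U ⊎ (∀ {T} → U ↭ a ∷ T → ConnectedOn G T)
    examine {a} a∈ with ∈-∃++ a∈
    ... | A , C , U≡ with connected⊎split (A ++ C)
    ...   | inj₁ conn′ = inj₂ λ σ x∈ y∈ → transport (drop-∷ (↭-trans (↭-sym τ) σ)) x∈ y∈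
      where
      τ = ↭-trans (↭-reflexive U≡) (shift a A C)
      transport : ∀ {T} → A ++ C ↭ T → ConnectedOn G T
      transport ρ x∈ y∈ = Inside-mono (∈-resp-↭ ρ) (conn′ (∈-resp-↭ (↭-sym ρ) x∈) (∈-resp-↭ (↭-sym ρ) y∈))
    ...   | inj₂ (S , R , ρ , s , r , sep) =
      inj₁ (a , S , R , ↭-trans (↭-reflexive U≡) (↭-trans (shift a A C) (prep a ρ)) , s , r , sep)
  ... | inj₁ cut = inj₁ cut
  ... | inj₂ f   = inj₂ (conn , λ σ → f (∈-resp-↭ (↭-sym σ) (here refl)) σ)

  module _ (cactus : EdgesInAtMostCycles 4 G) where

    SatisfiesBound : List V → Set
    SatisfiesBound U = pairs (adj G) U + Slack (length U) ≤ 2 * length U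

    pairs≤ : ∀ x xs k → pairs (adj G) xs ≤ k → pairs (adj G) (x ∷ xs) ≤ length xs + k
    pairs≤ x xs k h = +-mono-≤ (count≤length (adj G x) xs) h

    -- Complete graphs on one to four vertices meet the bound with equality, so there it suffices to
    -- count pairs.
    biconnected⇒bound : ∀ U → Unique U → Biconnected G U → 1 ≤ length U → SatisfiesBound U
    biconnected⇒bound (a ∷ [])             u bi _ = ≤-refl
    biconnected⇒bound (a ∷ b ∷ [])         u bi _ = +-monoˡ-≤ 3 (pairs≤ a (b ∷ []) 0 z≤n)
    biconnected⇒bound (a ∷ b ∷ c ∷ [])     u bi _ = +-monoˡ-≤ 3 (pairs≤ a (b ∷ c ∷ []) 1 (pairs≤ b (c ∷ []) 0 z≤n))
    biconnected⇒bound (a ∷ b ∷ c ∷ d ∷ []) u bi _ =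
      +-monoˡ-≤ 2 (pairs≤ a (b ∷ c ∷ d ∷ []) 3 (pairs≤ b (c ∷ d ∷ []) 1 (pairs≤ c (d ∷ []) 0 z≤n)))
    biconnected⇒bound U@(_ ∷ _ ∷ _ ∷ _ ∷ _ ∷ []) u bi _ =
      +-monoˡ-≤ 3 (graph₅-bound (pullback (lookup U) G)
        (restrict {H = pullback (lookup U) G} {G = G} record
          { image = lookup U ; injective = lookup-injective u ; edges = λ _ _ e → e } cactus))
    biconnected⇒bound U@(a ∷ b ∷ c ∷ d ∷ e ∷ f ∷ r) u@((a≢b All.∷ _) ∷ _) bi _ = begin
      pairs (adj G) U + Slack (length U) ≤⟨ +-mono-≤ bound (Slack≤3 (length U)) ⟩
      (3 + length U) + 3                 ≡⟨ arith (length r) ⟩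
      length U + 6                       ≤⟨ +-monoʳ-≤ (length U) (m≤m+n 6 (length r)) ⟩
      length U + length U                ≡⟨ cong (length U +_) (sym (+-identityʳ (length U))) ⟩
      2 * length U                       ∎
      where
      open ≤-Reasoning
      arith : ∀ k → (3 + (6 + k)) + 3 ≡ (6 + k) + 6
      arith = solve-∀
      bound : pairs (adj G) U ≤ 3 + length U
      -- The first step of a walk between two distinct vertices provides the base edge of the ear
      -- decomposition.
      bound with proj₁ bi (here refl) (there (here refl))
      ... | ε = contradiction refl a≢b
      ... | (a~q , a∈ , q∈) ◅ _ = EarDecomposition.biconnected-bound G cactus U u bi _ _ a∈ q∈ a~q

    glue-bound : ∀ {U a S R} → U ↭ a ∷ S ++ R → Separated S R →
      SatisfiesBound (a ∷ S) → SatisfiesBound (a ∷ R) → SatisfiesBound U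
    glue-bound {U} {a} {S} {R} σ sep boundS boundR
      rewrite pairs-↭ (adj G) (symm G) σ | ↭-length σ | pairs-glue (adj G) a S R sep | length-++ S {R} =
      -- The 2 is the contribution of `a`, which both sides count.
      +-cancelʳ-≤ 2 _ _ (begin
        (x + y) + Slack (suc (s + r)) + 2             ≡⟨ +-assoc (x + y) _ 2 ⟩
        (x + y) + (Slack (suc (s + r)) + 2)           ≤⟨ +-monoʳ-≤ (x + y) (Slack-glue s r) ⟩
        (x + y) + (Slack (suc s) + Slack (suc r))     ≡⟨ interchange x y (Slack (suc s)) (Slack (suc r)) ⟩
        (x + Slack (suc s)) + (y + Slack (suc r))     ≤⟨ +-mono-≤ boundS boundR ⟩
        2 * suc s + 2 * suc r                         ≡⟨ arith s r ⟩
        2 * suc (s + r) + 2                           ∎)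
      where
      open ≤-Reasoning
      x = pairs (adj G) (a ∷ S)
      y = pairs (adj G) (a ∷ R)
      s = length S
      r = length R
      arith : ∀ s r → 2 * suc s + 2 * suc r ≡ 2 * suc (s + r) + 2
      arith = solve-∀

    connected⇒bound : ∀ k U → length U ≤ k → Unique U → ConnectedOn G U → 1 ≤ length U → SatisfiesBound U
    connected⇒bound zero    []      _   _ _    ()
    connected⇒bound (suc k) U U≤k u conn 1≤ with cut⊎biconnected conn
    ... | inj₂ bi = biconnected⇒bound U u bi 1≤
    ... | inj₁ (a , S , R , σ , 0<S , 0<R , sep) = glue-bound σ sep
      (connected⇒bound k (a ∷ S) (≤-trans (m<m+n (length S) 0<R) size) (Unique-++⁻ˡ (a ∷ S) u′)
        (side-connected conn σ sep) (s≤s z≤n))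
      (connected⇒bound k (a ∷ R) (≤-trans (m<n+m (length R) 0<S) size) uniqueR
        (side-connected conn σ′ (λ i j → trans (symm G _ _) (sep j i))) (s≤s z≤n))
      where
      u′ = Unique-resp-↭ σ u
      size : length S + length R ≤ k
      size = s≤s⁻¹ (≤-trans (≤-reflexive (sym (trans (↭-length σ) (cong suc (length-++ S))))) U≤k)
      σ′ = ↭-trans σ (prep a (++-comm S R))
      uniqueR = Unique-++⁻ˡ (a ∷ R) (Unique-resp-↭ σ′ u)

upperBound : (n : ℕ) → 1 ≤ n → (G : Graph n) → IsCactus 4 G → edgeCount G + Slack n ≤ 2 * n
upperBound n 1≤n G (conn , cactus) = ≤-trans (+-monoˡ-≤ (Slack n) (≤-reflexive (edgeCount≡pairs G)))
  (subst (λ k → pairs (adj G) (allFin n) + Slack k ≤ 2 * k) (length-tabulate {n = n} id)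
    (connected⇒bound G cactus n (allFin n) (≤-reflexive (length-tabulate {n = n} id)) (allFin⁺ n) (λ _ _ → walk (conn _ _))
      (≤-trans 1≤n (≤-reflexive (sym (length-tabulate {n = n} id))))))
  where
  walk : ∀ {x y} → Walk G x y → Star (Inside G (allFin n)) x y
  walk []      = ε
  walk (e ∷ w) = (e , ∈-allFin _ , ∈-allFin _) ◅ walk w

-- The windmill graph

-- Quotient by 3, as `residue` is the remainder. Both recurse in steps of three, so that `mates` is
-- invariant under a shift by 3 definitionally.
group : ℕ → ℕ
group (suc (suc (suc i))) = suc (group i)
group _                   = 0

residue : ℕ → Fin 3
residue 0                   = 0F
residue 1                   = 1F
residue 2                   = 2F
residue (suc (suc (suc i))) = residue i

group-residue-injective : ∀ i j → group i ≡ group j → residue i ≡ residue j → i ≡ j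
group-residue-injective 0 0 _ _ = refl
group-residue-injective 1 1 _ _ = refl
group-residue-injective 2 2 _ _ = refl
group-residue-injective (suc (suc (suc i))) (suc (suc (suc j))) p q =
  cong (3 +_) (group-residue-injective i j (cong pred p) q)
group-residue-injective 0 1 _ ()
group-residue-injective 0 2 _ ()
group-residue-injective 1 0 _ ()
group-residue-injective 1 2 _ ()
group-residue-injective 2 0 _ ()
group-residue-injective 2 1 _ ()
group-residue-injective 0 (suc (suc (suc _))) () _
group-residue-injective 1 (suc (suc (suc _))) () _
group-residue-injective 2 (suc (suc (suc _))) () _
group-residue-injective (suc (suc (suc _))) 0 () _
group-residue-injective (suc (suc (suc _))) 1 () _
group-residue-injective (suc (suc (suc _))) 2 () _

mates : ℕ → ℕ → Bool
mates i j = not (i ≡ᵇ j) ∧ (group i ≡ᵇ group j)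

-- Vertex 0 is the hub, and vertex `suc i` belongs to blade `group i`. Truncation at `n` vertices
-- may leave the last blade incomplete, which yields the K₂ or K₃.
windmillAdj : ℕ → ℕ → Bool
windmillAdj zero    zero    = false
windmillAdj zero    (suc j) = true
windmillAdj (suc i) zero    = true
windmillAdj (suc i) (suc j) = mates i j

≡ᵇ-sym : ∀ i j → (i ≡ᵇ j) ≡ (j ≡ᵇ i)
≡ᵇ-sym zero    zero    = refl
≡ᵇ-sym zero    (suc j) = refl
≡ᵇ-sym (suc i) zero    = refl
≡ᵇ-sym (suc i) (suc j) = ≡ᵇ-sym i j

windmillAdj-sym : ∀ i j → windmillAdj i j ≡ windmillAdj j i
windmillAdj-sym zero    zero    = refl
windmillAdj-sym zero    (suc j) = refl
windmillAdj-sym (suc i) zero    = refl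
windmillAdj-sym (suc i) (suc j) rewrite ≡ᵇ-sym i j | ≡ᵇ-sym (group i) (group j) = refl

windmillAdj-irrefl : ∀ i → windmillAdj i i ≡ false
windmillAdj-irrefl zero = refl
windmillAdj-irrefl (suc i) rewrite Equivalence.to T-≡ (≡⇒≡ᵇ i i refl) = refl

windmill : ∀ n → Graph n
windmill n = record
  { adj    = λ u v → windmillAdj (toℕ u) (toℕ v)
  ; symm   = λ u v → windmillAdj-sym (toℕ u) (toℕ v)
  ; irrefl = λ u → windmillAdj-irrefl (toℕ u)
  }

windmill-connected : ∀ n → Connected (windmill n)
windmill-connected (suc n) u v = to-hub u v
  where
  from-hub : ∀ v → Walk (windmill (suc n)) zero v
  from-hub zero    = []
  from-hub (suc v) = refl ∷ []
  to-hub : ∀ u v → Walk (windmill (suc n)) u v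
  to-hub zero    v = from-hub v
  to-hub (suc u) v = _∷_ {v = zero} refl (from-hub v)

-- The hub 0 belongs to every blade; its blade number is a junk value.
blade : ℕ → ℕ
blade zero    = 0
blade (suc i) = group i

place : ℕ → Fin 4
place zero    = 0F
place (suc i) = suc (residue i)

blade-place-injective : ∀ x y → (x ≢ 0 → y ≢ 0 → blade x ≡ blade y) → place x ≡ place y → x ≡ y
blade-place-injective zero    zero    _ _ = refl
blade-place-injective (suc i) (suc j) h e = cong suc (group-residue-injective i j (h (λ ()) (λ ())) (sucᶠ-injective e))

Adj⇒same-blade : ∀ x y → windmillAdj x y ≡ true → x ≢ 0 → y ≢ 0 → blade x ≡ blade y
Adj⇒same-blade zero    y       a x≢0 y≢0 = contradiction refl x≢0
Adj⇒same-blade (suc i) zero    a x≢0 y≢0 = contradiction refl y≢0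
Adj⇒same-blade (suc i) (suc j) a x≢0 y≢0 = ≡ᵇ⇒≡ _ _ (proj₂ (Equivalence.to T-∧ (Equivalence.from T-≡ a)))

Chain : ∀ {k} → (Fin (suc k) → ℕ) → Set
Chain {k} f = ∀ (i : Fin k) → windmillAdj (f (inject₁ i)) (f (suc i)) ≡ true

-- A walk can change blades only at the hub. The position of that visit is recorded so that visits
-- before and after `i` are known to differ.
from-first : ∀ {k} (f : Fin (suc k) → ℕ) → Chain f → ∀ i → f i ≢ 0 →
  (∃ λ j → j <ᶠ i × f j ≡ 0) ⊎ (f zero ≢ 0 × blade (f zero) ≡ blade (f i))
from-first f s zero    ne = inj₂ (ne , refl)
from-first {suc k} f s (suc i) ne with from-first (f ∘ suc) (s ∘ suc) i ne
... | inj₁ (j , j<i , e) = inj₁ (suc j , s≤s j<i , e)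
... | inj₂ (ne′ , e) with f zero ≟ 0
...   | yes hub = inj₁ (zero , s≤s z≤n , hub)
...   | no  ne₀ = inj₂ (ne₀ , trans (Adj⇒same-blade _ _ (s zero) ne₀ ne′) e)

to-last : ∀ {k} (f : Fin (suc k) → ℕ) → Chain f → ∀ i → f i ≢ 0 →
  (∃ λ j → i <ᶠ j × f j ≡ 0) ⊎ (f (fromℕ k) ≢ 0 × blade (f i) ≡ blade (f (fromℕ k)))
to-last {zero}  f s zero ne = inj₂ (ne , refl)
to-last {suc k} f s (suc i) ne with to-last (f ∘ suc) (s ∘ suc) i ne
... | inj₁ (j , i<j , e) = inj₁ (suc j , s≤s i<j , e)
... | inj₂ r             = inj₂ r
to-last {suc k} f s zero ne with f (suc zero) ≟ 0
... | yes hub = inj₁ (suc zero , s≤s z≤n , hub)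
... | no  ne₁ with to-last (f ∘ suc) (s ∘ suc) zero ne₁
...   | inj₁ (j , i<j , e) = inj₁ (suc j , s≤s z≤n , e)
...   | inj₂ (neₗ , e)     = inj₂ (neₗ , trans (Adj⇒same-blade _ _ (s zero) ne ne₁) e)

module _ {n} (c : Cycle (windmill n)) where

  private
    f : Fin (3 + m c) → ℕ
    f = toℕ ∘ vtx c

  -- The hub is visited at most once, so every other vertex is joined to the first or to the last one
  -- along the cycle without meeting the hub.
  reaches-end : ∀ i → f i ≢ 0 →
    (f zero ≢ 0 × blade (f zero) ≡ blade (f i)) ⊎ (f (fromℕ (2 + m c)) ≢ 0 × blade (f i) ≡ blade (f (fromℕ (2 + m c))))
  reaches-end i ne with from-first f (step c) i ne | to-last f (step c) i ne
  ... | inj₂ r | _      = inj₁ r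
  ... | inj₁ _ | inj₂ r = inj₂ r
  ... | inj₁ (j , j<i , hub) | inj₁ (k , i<k , hub′) =
    contradiction (inj c (toℕ-injective (trans hub (sym hub′)))) (<ᶠ⇒≢ (<-trans j<i i<k))

  -- If the two vertices are linked to opposite ends of the sequence, neither end is the hub and the
  -- closing edge links the ends.
  cycle-in-blade : ∀ i j → f i ≢ 0 → f j ≢ 0 → blade (f i) ≡ blade (f j)
  cycle-in-blade i j nᵢ nⱼ with reaches-end i nᵢ | reaches-end j nⱼ
  ... | inj₁ (_ , p) | inj₁ (_ , q) = trans (sym p) q
  ... | inj₂ (_ , p) | inj₂ (_ , q) = trans p (sym q)
  ... | inj₁ (n₀ , p) | inj₂ (nₗ , q) = trans (sym p) (trans (sym (Adj⇒same-blade _ _ (close c) nₗ n₀)) (sym q))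
  ... | inj₂ (nₗ , p) | inj₁ (n₀ , q) = trans p (trans (Adj⇒same-blade _ _ (close c) nₗ n₀) q)

  -- A blade together with the hub is read as a K₄ on `Fin 4`. As the cycle stays in one blade, this
  -- reading is injective and the cycle has at most four vertices.
  places : Fin (3 + m c) → Fin 4
  places = place ∘ f

  places-injective : ∀ {i j} → places i ≡ places j → i ≡ j
  places-injective {i} {j} e = inj c (toℕ-injective (blade-place-injective (f i) (f j) (cycle-in-blade i j) e))

-- The cycles of K₄ through a given edge

SameSeq : ∀ {n k l} → (Fin (suc k) → Fin n) → (Fin (suc l) → Fin n) → Set
SameSeq f g = ∀ a b → (OnSeq f a b → OnSeq g a b) × (OnSeq g a b → OnSeq f a b)

SameSeq? : ∀ {n k l} (f : Fin (suc k) → Fin n) (g : Fin (suc l) → Fin n) → Dec (SameSeq f g)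
SameSeq? f g = all? λ a → all? λ b → (OnSeq? f a b →-dec OnSeq? g a b) ×-dec (OnSeq? g a b →-dec OnSeq? f a b)

-- For distinct `u` and `v` the filter leaves exactly two vertices; the last clause is a mere
-- default.
others : Fin 4 → Fin 4 → Fin 4 × Fin 4
others u v with filter (λ w → ¬? (w ≟ᶠ u) ×-dec ¬? (w ≟ᶠ v)) (allFin 4)
... | p ∷ q ∷ _ = p , q
... | _         = u , v

-- One triangle for each further vertex and one quadrilateral for each order of the two: the four
-- cycles through an edge.
K₄-cycle : Fin 4 → Fin 4 → Fin 4 → ∃ λ k → Vec (Fin 4) (suc k)
K₄-cycle u v t with others u v
K₄-cycle u v 0F | p , q = 2 , u ∷ v ∷ p ∷ []
K₄-cycle u v 1F | p , q = 2 , u ∷ v ∷ q ∷ []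
K₄-cycle u v 2F | p , q = 3 , u ∷ v ∷ p ∷ q ∷ []
K₄-cycle u v 3F | p , q = 3 , u ∷ v ∷ q ∷ p ∷ []

Classified : ∀ {k} → (Fin (suc k) → Fin 4) → Fin 4 → Fin 4 → Set
Classified f u v = ∃ λ t → SameSeq f (Vec.lookup (proj₂ (K₄-cycle u v t)))

-- A cycle may be listed from any start and in either direction, hence the comparison by edges. All
-- sequences of the given length are checked.
Classification : ℕ → Set
Classification k = ∀ (w : Vec (Fin 4) (suc k)) → (∀ x y → Vec.lookup w x ≡ Vec.lookup w y → x ≡ y) →
  ∀ u v → OnSeq (Vec.lookup w) u v → Classified (Vec.lookup w) u v

Classification? : ∀ k → Dec (Classification k)
Classification? k = ∀Vec? all? (suc k) λ w → Injective? (Vec.lookup w) →-dec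
  (all? λ u → all? λ v → OnSeq? (Vec.lookup w) u v →-dec
    anyFin? λ t → SameSeq? (Vec.lookup w) (Vec.lookup (proj₂ (K₄-cycle u v t))))

abstract
  triangles : Classification 2
  triangles = toWitness {a? = Classification? 2} tt

  quadrilaterals : Classification 3
  quadrilaterals = toWitness {a? = Classification? 3} tt

OnSeq-cong : ∀ {n k} {f g : Fin (suc k) → Fin n} → (∀ i → f i ≡ g i) → ∀ {u v} → OnSeq f u v → OnSeq g u v
OnSeq-cong f≗g (inj₁ (i , inj₁ (p , q))) = inj₁ (i , inj₁ (trans p (f≗g _) , trans q (f≗g _)))
OnSeq-cong f≗g (inj₁ (i , inj₂ (p , q))) = inj₁ (i , inj₂ (trans p (f≗g _) , trans q (f≗g _)))
OnSeq-cong f≗g (inj₂ (inj₁ (p , q)))     = inj₂ (inj₁ (trans p (f≗g _) , trans q (f≗g _)))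
OnSeq-cong f≗g (inj₂ (inj₂ (p , q)))     = inj₂ (inj₂ (trans p (f≗g _) , trans q (f≗g _)))

classify : ∀ m (f : Fin (3 + m) → Fin 4) → (∀ {i j} → f i ≡ f j → i ≡ j) → ∀ {u v} → OnSeq f u v → Classified f u v
classify m f f-inj {u} {v} on = dispatch m f f-inj on (injective⇒≤ {f = f} f-inj)
  where
  apply : ∀ {k} → Classification k → (f : Fin (suc k) → Fin 4) → (∀ {i j} → f i ≡ f j → i ≡ j) →
    OnSeq f u v → Classified f u v
  apply cl f f-inj on
    with t , same ← cl (Vec.tabulate f) (λ x y e → f-inj (trans (sym (lookup∘tabulate f x)) (trans e (lookup∘tabulate f y))))
                      u v (OnSeq-cong (sym ∘ lookup∘tabulate f) on) =
    t , λ a b → (proj₁ (same a b) ∘ OnSeq-cong (sym ∘ lookup∘tabulate f)) , (OnSeq-cong (lookup∘tabulate f) ∘ proj₂ (same a b))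
  dispatch : ∀ m (f : Fin (3 + m) → Fin 4) → (∀ {i j} → f i ≡ f j → i ≡ j) → OnSeq f u v → 3 + m ≤ 4 → Classified f u v
  dispatch 0 f f-inj on _ = apply triangles f f-inj on
  dispatch 1 f f-inj on _ = apply quadrilaterals f f-inj on
  dispatch (suc (suc m)) f f-inj on (s≤s (s≤s (s≤s (s≤s ()))))

module _ {n : ℕ} where

  private
    V = Fin n
    loc : V → Fin 4
    loc = place ∘ toℕ

  OnCycle-ends : ∀ (c : Cycle (windmill n)) {u v} → OnCycle c u v → (∃ λ i → u ≡ vtx c i) × (∃ λ j → v ≡ vtx c j)
  OnCycle-ends c (inj₁ (i , inj₁ (p , q))) = (_ , p) , (_ , q)
  OnCycle-ends c (inj₁ (i , inj₂ (p , q))) = (_ , p) , (_ , q)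
  OnCycle-ends c (inj₂ (inj₁ (p , q)))     = (_ , p) , (_ , q)
  OnCycle-ends c (inj₂ (inj₂ (p , q)))     = (_ , p) , (_ , q)

  edgeBlade : V → V → ℕ
  edgeBlade u v with toℕ u
  ... | zero  = blade (toℕ v)
  ... | suc i = group i

  OnCycle-blade : ∀ (c : Cycle (windmill n)) {u v} → Adj (windmill n) u v → OnCycle c u v →
    ∀ i → toℕ (vtx c i) ≢ 0 → blade (toℕ (vtx c i)) ≡ edgeBlade u v
  OnCycle-blade c {u} {v} a on i ne with OnCycle-ends c on
  ... | (j , refl) , (k , refl) with toℕ (vtx c j) in eq
  ...   | suc _ = trans (cycle-in-blade c i j ne (λ e → 0≢1+n (trans (sym e) eq))) (cong blade eq)
  ...   | zero  = cycle-in-blade c i k ne λ e → 0≢1 (trans (sym (cong (windmillAdj 0) e)) a)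
    where
    0≢1 : windmillAdj 0 0 ≡ true → ⊥
    0≢1 ()

  InBlade : ℕ → V → Set
  InBlade β x = toℕ x ≢ 0 → blade (toℕ x) ≡ β

  loc-injective : ∀ {β x y} → InBlade β x → InBlade β y → loc x ≡ loc y → x ≡ y
  loc-injective hx hy e = toℕ-injective (blade-place-injective _ _ (λ p q → trans (hx p) (sym (hy q))) e)

  OnCycle⇒OnSeq : ∀ (c : Cycle (windmill n)) {x y} → OnCycle c x y → OnSeq (places c) (loc x) (loc y)
  OnCycle⇒OnSeq c (inj₁ (i , inj₁ (refl , refl))) = inj₁ (i , inj₁ (refl , refl))
  OnCycle⇒OnSeq c (inj₁ (i , inj₂ (refl , refl))) = inj₁ (i , inj₂ (refl , refl))
  OnCycle⇒OnSeq c (inj₂ (inj₁ (refl , refl)))     = inj₂ (inj₁ (refl , refl))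
  OnCycle⇒OnSeq c (inj₂ (inj₂ (refl , refl)))     = inj₂ (inj₂ (refl , refl))

  OnSeq⇒OnCycle : ∀ {β} (c : Cycle (windmill n)) → (∀ i → InBlade β (vtx c i)) → ∀ {x y} → InBlade β x → InBlade β y →
    OnSeq (places c) (loc x) (loc y) → OnCycle c x y
  OnSeq⇒OnCycle c h hx hy (inj₁ (i , inj₁ (p , q))) = inj₁ (i , inj₁ (loc-injective hx (h _) p , loc-injective hy (h _) q))
  OnSeq⇒OnCycle c h hx hy (inj₁ (i , inj₂ (p , q))) = inj₁ (i , inj₂ (loc-injective hx (h _) p , loc-injective hy (h _) q))
  OnSeq⇒OnCycle c h hx hy (inj₂ (inj₁ (p , q)))     = inj₂ (inj₁ (loc-injective hx (h _) p , loc-injective hy (h _) q))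
  OnSeq⇒OnCycle c h hx hy (inj₂ (inj₂ (p , q)))     = inj₂ (inj₂ (loc-injective hx (h _) p , loc-injective hy (h _) q))

  SameSeq⇒OnCycle : ∀ {β} (c d : Cycle (windmill n)) → (∀ i → InBlade β (vtx c i)) → (∀ i → InBlade β (vtx d i)) →
    (∀ {a b} → OnSeq (places c) a b → OnSeq (places d) a b) → ∀ {x y} → OnCycle c x y → OnCycle d x y
  SameSeq⇒OnCycle c d hc hd imp on with OnCycle-ends c on
  ... | (i , refl) , (j , refl) = OnSeq⇒OnCycle d hd (hc i) (hc j) (imp (OnCycle⇒OnSeq c on))

  -- Two of five cycles fall into the same of four classes, so their edges agree as edges of K₄.
  -- Both contain the given edge, so they lie in the same blade, where the place determines the
  -- vertex.
  windmill-cactus : EdgesInAtMostCycles 4 (windmill n)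
  windmill-cactus u v u~v cs on = i , j , <ᶠ⇒≢ i<j , λ x y →
      SameSeq⇒OnCycle (cs i) (cs j) (in-blade i) (in-blade j)
        (λ {a} {b} → proj₂ (same j a b) ∘ transfer eq ∘ proj₁ (same i a b))
    , SameSeq⇒OnCycle (cs j) (cs i) (in-blade j) (in-blade i)
        (λ {a} {b} → proj₂ (same i a b) ∘ transfer (sym eq) ∘ proj₁ (same j a b))
    where
    in-blade : ∀ i k → InBlade (edgeBlade u v) (vtx (cs i) k)
    in-blade i = OnCycle-blade (cs i) u~v (on i)
    class : ∀ i → Classified (places (cs i)) (loc u) (loc v)
    class i = classify (m (cs i)) (places (cs i)) (places-injective (cs i)) (OnCycle⇒OnSeq (cs i) (on i))
    same = proj₂ ∘ class
    coincidence = pigeonhole (n<1+n 4) (proj₁ ∘ class)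
    i = proj₁ coincidence
    j = proj₁ (proj₂ coincidence)
    i<j = proj₁ (proj₂ (proj₂ coincidence))
    eq = proj₂ (proj₂ (proj₂ coincidence))
    transfer : ∀ {s t a b} → s ≡ t → OnSeq (Vec.lookup (proj₂ (K₄-cycle (loc u) (loc v) s))) a b →
      OnSeq (Vec.lookup (proj₂ (K₄-cycle (loc u) (loc v) t))) a b
    transfer refl = id

-- The number of edges of the windmill

module _ {A B : Set} where

  count-tabulate : ∀ {m} {p : A → Bool} {q : B → Bool} {f : Fin m → A} {g : Fin m → B} → (∀ i → p (f i) ≡ q (g i)) →
    count p (tabulate f) ≡ count q (tabulate g)
  count-tabulate {zero}  h = refl
  count-tabulate {suc m} h = cong₂ _+_ (cong indicator (h zero)) (count-tabulate {m} (h ∘ suc))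

  pairs-tabulate : ∀ {m} {a : A → A → Bool} {b : B → B → Bool} {f : Fin m → A} {g : Fin m → B} →
    (∀ i j → a (f i) (f j) ≡ b (g i) (g j)) → pairs a (tabulate f) ≡ pairs b (tabulate g)
  pairs-tabulate {zero}  h = refl
  pairs-tabulate {suc m} h = cong₂ _+_ (count-tabulate {m} (h zero ∘ suc)) (pairs-tabulate {m} λ i j → h (suc i) (suc j))

count-const : ∀ {A : Set} {m} {p : A → Bool} {f : Fin m → A} b → (∀ i → p (f i) ≡ b) → count p (tabulate f) ≡ m * indicator b
count-const {m = zero}  b h = refl
count-const {m = suc m} b h = cong₂ _+_ (cong indicator (h zero)) (count-const {m = m} b (h ∘ suc))

matePairs : ℕ → ℕ
matePairs m = pairs mates (tabulate {n = m} toℕ)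

-- The first three vertices form a full group: three pairs among themselves, none with later
-- vertices. The rest is a shifted copy.
matePairs-step : ∀ m → matePairs (3 + m) ≡ 3 + matePairs m
matePairs-step m
  rewrite count-const {m = m} {mates 0} {λ i → 3 + toℕ i} false (λ _ → refl)
        | count-const {m = m} {mates 1} {λ i → 3 + toℕ i} false (λ _ → refl)
        | count-const {m = m} {mates 2} {λ i → 3 + toℕ i} false (λ _ → refl)
        | *-zeroʳ m = cong (3 +_) (pairs-tabulate {m = m} λ _ _ → refl)

windmill-edgeCount : ∀ m → edgeCount (windmill (suc m)) ≡ m + matePairs m
windmill-edgeCount m = trans (edgeCount≡pairs (windmill (suc m))) (cong₂ _+_
  (trans (count-const {m = m} true (λ _ → refl)) (*-identityʳ m)) (pairs-tabulate {m = m} λ _ _ → refl))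

matePairs-bound : ∀ m → (m + matePairs m) + Slack (suc m) ≡ 2 * suc m
matePairs-bound 0 = refl
matePairs-bound 1 = refl
matePairs-bound 2 = refl
-- A further blade adds three spokes and three mate pairs, just the growth of `2 * n` by 6, and
-- leaves the slack unchanged.
matePairs-bound (suc (suc (suc m))) rewrite matePairs-step m =
  trans (regroup m (matePairs m) (Slack (suc m))) (trans (cong (6 +_) (matePairs-bound m)) (double m))
  where
  regroup : ∀ m k s → (3 + m + (3 + k)) + s ≡ 6 + ((m + k) + s)
  regroup = solve-∀
  double : ∀ m → 6 + 2 * suc m ≡ 2 * suc (3 + m)
  double = solve-∀

tight : (n : ℕ) → 1 ≤ n → Σ (Graph n) λ G → IsCactus 4 G × (edgeCount G + Slack n ≡ 2 * n)
tight (suc m) _ = windmill (suc m) , (windmill-connected (suc m) , windmill-cactus) ,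
  trans (cong (_+ Slack (suc m)) (windmill-edgeCount m)) (matePairs-bound m)

theorem4 : ((n : ℕ) → 1 ≤ n → (G : Graph n) → IsCactus 4 G →
    edgeCount G + Slack n ≤ 2 * n)
    × ((n : ℕ) → 1 ≤ n →
    Σ (Graph n) λ G → IsCactus 4 G × (edgeCount G + Slack n ≡ 2 * n))
theorem4 = upperBound , tight
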